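{- (i) The theory $\Delta\mathsf{RA}_1$ proves the induction principles $\mathrm{I}[\Delta^0_0(X,\vec f)]$, i.e. for every bounded formula $\varphi(x)$ of $L_1(X,\vec f)$ (possibly with parameters) it proves the universal closure of $\varphi(0)\land\forall x(\varphi(x)\to\varphi(x+1))\to\forall x\,\varphi(x)$; and it proves that the functions $\vec f$ are polynomially bounded, i.e. for every derivation $d$ there is a term $t(x)$ of $L_1$ such that $\Delta\mathsf{RA}_1\vdash\forall x,y\,(f_d(x)=y\to y\le t(x))$. (ii) Vice versa, any inductive theory $\mathrm{I}\Delta^0_0(X)$ can be extended by definitions to the theory $\Delta\mathsf{RA}_1$.
   Context: **Language $L_1$ and BASIC.** $L_1$ is the first-order language with constant $0$, unary function symbols $S,H,T$, binary function symbols $+,\cdot$, a binary pairing function symbol $(\cdot,\cdot)$, and a binary relation $<$. Write $1=S(0)$, $2=S(S(0))$, and $x\le y$ for $x<y\lor x=y$. Pairing associates to the right, and $f(x,y)$ means $f((x,y))$. BASIC consists of the universal closures of: $S(x)\neq 0$; $S(x)=S(y)\to x=y$; $x+0=x$; $x+S(y)=S(x+y)$; $x\cdot 0=0$; $x\cdot S(y)=x\cdot y+x$; $\lnot x<0$; $x<S(y)\leftrightarrow x<y\lor x=y$; $x<y\lor x=y\lor y<x$; $0<x\to\exists y<x\,S(y)=x$; $(x,y)=z\leftrightarrow 2\cdot z=(x+y)\cdot(x+y+1)+2\cdot x+2$; $(x,y)=(x',y')\to x=x'\land y=y'$; $z>0\to\exists x,y<z\,(x,y)=z$; $H((x,y))=x$;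 $H(0)=0$; $T((x,y))=y$; $T(0)=0$. **Set constants and functions.** $L_1(X,\vec f)$ is $L_1$ with additional unary predicate symbols ("set constants") $X$ and $f_d$ ($d$ ranging over derivations, below); $t\in X$ is written for $X(t)$. For a set constant $f$, $f\in\mathcal F$ abbreviates $\forall x\exists y\,(x,y)\in f\land\forall x,y,y'((x,y)\in f\land(x,y')\in f\to y=y')\land 0\notin f$; $f(t)=s$ abbreviates $(t,s)\in f$. **Inductive theory $\mathrm{I}\Delta^0_0(X)$.** This is the theory in $L_1(X)$ consisting of BASIC and the induction principles for all bounded formulas of $L_1(X)$ (the set constant $X$ may occur in them; parameters allowed). **Operators of $\Delta$.** Each is the universal closure (over number variables) of the displayed formula: - $f:=\mathrm S$: $f(x)=S(x)$; - $f:=\oplus$: $f(x,y)=x+y\land f(0)=0$; - $f:=\otimes$: $f(x,y)=x\cdot y\land f(0)=0$; - $f:={<_\ast}$: $(x<y\to f(x,y)=1)\land(x\ge y\to f(x,y)=0)\land f(0)=0$; - $f:=\mathrm I$: $f(x)=x$; - $f:=\mathrm D$: $f(0,y,z)=y\land f(S(x),y,z)=z\land f(0)=0\land f(x,0)=0$; - $f:=\mathrm P(g,h)$: $g(x)=v\land h(x)=w\to f(x)=(v,w)$; - $f:=g\circ h$: $h(x)=z\land g(z)=y\to f(x)=y$; - $f:=\mu(g)$: $(f(b,x)=z\to z\le b)\land(f(b,x)=z\land y<b\land g(y,x)=1\to z\le y)\land(f(b,x)=z\land z<b\to g(z,x)=1)\land f(0)=0$. The oracle operator $f:=X_\ast$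 is $\forall x((x\in X\to f(x)=1)\land(x\notin X\to f(x)=0))$. **Derivations and $\Delta\mathsf{RA}_1$.** Derivations are the least set of formal terms containing the symbol $X_\ast$ and containing $\mathrm{op}(d_1,\dots,d_n)$ for each $n$-ary operator $\mathrm{op}$ of $\Delta$ and derivations $d_1,\dots,d_n$. $\Delta\mathsf{RA}_1$ is the theory in $L_1(X,\vec f)$ consisting of BASIC, the oracle axioms $f_{X_\ast}:=X_\ast$ and $f_{X_\ast}\in\mathcal F$, and for each operator $\mathrm{op}$ of $\Delta$ and derivations $d_1,\dots,d_n$ the operator axioms $f_{\mathrm{op}(d_1,\dots,d_n)}:=\mathrm{op}(f_{d_1},\dots,f_{d_n})$ and $f_{\mathrm{op}(d_1,\dots,d_n)}\in\mathcal F$. -}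

module Defs where

open import Data.Nat.Base using (ℕ; zero; suc)
open import Data.Fin.Base using (Fin; zero; suc)
open import Data.List.Base using (List; []; _∷_; map)
open import Data.List.Membership.Propositional using () renaming (_∈_ to _∈ˡ_)
open import Data.Vec.Base as Vec using (Vec; []; _∷_)
open import Data.Product.Base using (Σ-syntax)
open import Data.Sum.Base using (_⊎_; inj₁; inj₂)
open import Data.Unit.Base using (⊤; tt)
open import Function.Bundles using () renaming (_⇔_ to _⟺_)

infixl 9 _[_]
infixl 8 _·_
infixl 7 _+_
infix  6 _≐_ _<_ _≤_ _∈_ _∉_ _⟨_⟩≐_
infixr 5 ¬_ ∀̇_ ∃̇_
infixr 4 _∧_
infixr 3 _∨_
infixr 2 _⇒_
infix  1 _⇔_
infix  0 _∣_⊢_ _⊢_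

------------------------------------------------------------------------
-- Syntax

-- Terms of L₁ with free variables among n de Bruijn indices.
data Term (n : ℕ) : Set where
  var     : Fin n → Term n
  𝟎       : Term n
  S H T   : Term n → Term n
  _+_ _·_ : Term n → Term n → Term n
  ⟪_,_⟫   : Term n → Term n → Term n

pattern v₀ = var zero
pattern v₁ = var (suc zero)
pattern v₂ = var (suc (suc zero))
pattern v₃ = var (suc (suc (suc zero)))

𝟏 𝟐 : ∀ {n} → Term n
𝟏 = S 𝟎
𝟐 = S (S 𝟎)

-- Formulas of L₁ extended by the elements of C as set constants.
data Formula (C : Set) (n : ℕ) : Set where
  _≐_ _<_     : Term n → Term n → Formula C n
  _∈_         : Term n → C → Formula C n
  ⊥           : Formula C n
  _⇒_ _∧_ _∨_ : Formula C n → Formula C n → Formula C n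
  ∀̇_ ∃̇_      : Formula C (suc n) → Formula C n

Sentence : Set → Set
Sentence C = Formula C 0

Theory : Set → Set₁
Theory C = Sentence C → Set

private
  variable
    C C′ N : Set
    m n    : ℕ

¬_ : Formula C n → Formula C n
¬ φ = φ ⇒ ⊥

_⇔_ : Formula C n → Formula C n → Formula C n
φ ⇔ ψ = (φ ⇒ ψ) ∧ (ψ ⇒ φ)

_≤_ : Term n → Term n → Formula C n
s ≤ t = s < t ∨ s ≐ t

_∉_ : Term n → C → Formula C n
t ∉ f = ¬ (t ∈ f)

_⟨_⟩≐_ : C → Term n → Term n → Formula C n
f ⟨ t ⟩≐ s = ⟪ t , s ⟫ ∈ f

------------------------------------------------------------------------
-- Renaming and substitution

renameᵗ : (Fin m → Fin n) → Term m → Term n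
renameᵗ ρ (var i)   = var (ρ i)
renameᵗ ρ 𝟎         = 𝟎
renameᵗ ρ (S t)     = S (renameᵗ ρ t)
renameᵗ ρ (H t)     = H (renameᵗ ρ t)
renameᵗ ρ (T t)     = T (renameᵗ ρ t)
renameᵗ ρ (s + t)   = renameᵗ ρ s + renameᵗ ρ t
renameᵗ ρ (s · t)   = renameᵗ ρ s · renameᵗ ρ t
renameᵗ ρ ⟪ s , t ⟫ = ⟪ renameᵗ ρ s , renameᵗ ρ t ⟫

wkᵗ : Term n → Term (suc n)
wkᵗ = renameᵗ suc

substᵗ : (Fin m → Term n) → Term m → Term n
substᵗ σ (var i)   = σ i
substᵗ σ 𝟎         = 𝟎
substᵗ σ (S t)     = S (substᵗ σ t)
substᵗ σ (H t)     = H (substᵗ σ t)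
substᵗ σ (T t)     = T (substᵗ σ t)
substᵗ σ (s + t)   = substᵗ σ s + substᵗ σ t
substᵗ σ (s · t)   = substᵗ σ s · substᵗ σ t
substᵗ σ ⟪ s , t ⟫ = ⟪ substᵗ σ s , substᵗ σ t ⟫

liftˢ : (Fin m → Term n) → Fin (suc m) → Term (suc n)
liftˢ σ zero    = v₀
liftˢ σ (suc i) = wkᵗ (σ i)

subst : (Fin m → Term n) → Formula C m → Formula C n
subst σ (s ≐ t) = substᵗ σ s ≐ substᵗ σ t
subst σ (s < t) = substᵗ σ s < substᵗ σ t
subst σ (t ∈ f) = substᵗ σ t ∈ f
subst σ ⊥       = ⊥
subst σ (φ ⇒ ψ) = subst σ φ ⇒ subst σ ψ
subst σ (φ ∧ ψ) = subst σ φ ∧ subst σ ψ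
subst σ (φ ∨ ψ) = subst σ φ ∨ subst σ ψ
subst σ (∀̇ φ)  = ∀̇ subst (liftˢ σ) φ
subst σ (∃̇ φ)  = ∃̇ subst (liftˢ σ) φ

wk : Formula C n → Formula C (suc n)
wk = subst (λ i → var (suc i))

-- A sentence regarded as a formula in n free variables.
weaken₀ : Sentence C → Formula C n
weaken₀ = subst (λ ())

-- Substitution for index 0, closing the gap.
instantiate : Term n → Fin (suc n) → Term n
instantiate t zero    = t
instantiate t (suc i) = var i

_[_] : Formula C (suc n) → Term n → Formula C n
φ [ t ] = subst (instantiate t) φ

-- φ(x) ↦ φ(t(x)): index 0 stays in scope in t.
update : Term (suc n) → Fin (suc n) → Term (suc n)
update t zero    = t
update t (suc i) = var (suc i)

replace₀ : Term (suc n) → Formula C (suc n) → Formula C (suc n)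
replace₀ t = subst (update t)

mapConst : (C → C′) → Formula C n → Formula C′ n
mapConst ι (s ≐ t) = s ≐ t
mapConst ι (s < t) = s < t
mapConst ι (t ∈ f) = t ∈ ι f
mapConst ι ⊥       = ⊥
mapConst ι (φ ⇒ ψ) = mapConst ι φ ⇒ mapConst ι ψ
mapConst ι (φ ∧ ψ) = mapConst ι φ ∧ mapConst ι ψ
mapConst ι (φ ∨ ψ) = mapConst ι φ ∨ mapConst ι ψ
mapConst ι (∀̇ φ)  = ∀̇ mapConst ι φ
mapConst ι (∃̇ φ)  = ∃̇ mapConst ι φ

closure : ∀ n → Formula C n → Sentence C
closure zero    φ = φ
closure (suc n) φ = closure n (∀̇ φ)

∀<[_]_ ∃<[_]_ : Term n → Formula C (suc n) → Formula C n
∀<[ t ] φ = ∀̇ (v₀ < wkᵗ t ⇒ φ)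
∃<[ t ] φ = ∃̇ (v₀ < wkᵗ t ∧ φ)

data Bounded {C : Set} {n : ℕ} : Formula C n → Set where
  _≐_ : ∀ s t → Bounded (s ≐ t)
  _<_ : ∀ s t → Bounded (s < t)
  _∈_ : ∀ t f → Bounded (t ∈ f)
  ⊥   : Bounded ⊥
  _⇒_ : ∀ {φ ψ} → Bounded φ → Bounded ψ → Bounded (φ ⇒ ψ)
  _∧_ : ∀ {φ ψ} → Bounded φ → Bounded ψ → Bounded (φ ∧ ψ)
  _∨_ : ∀ {φ ψ} → Bounded φ → Bounded ψ → Bounded (φ ∨ ψ)
  all : ∀ t {φ} → Bounded φ → Bounded (∀<[ t ] φ)
  ex  : ∀ t {φ} → Bounded φ → Bounded (∃<[ t ] φ)

------------------------------------------------------------------------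
-- Classical first-order logic with equality (natural deduction)

data _∣_⊢_ {C : Set} (Ax : Theory C) {n : ℕ}
           (Γ : List (Formula C n)) : Formula C n → Set where
  axiom   : ∀ {φ} → Ax φ → Ax ∣ Γ ⊢ weaken₀ φ
  hyp     : ∀ {φ} → φ ∈ˡ Γ → Ax ∣ Γ ⊢ φ
  raa     : ∀ {φ} → Ax ∣ (¬ φ) ∷ Γ ⊢ ⊥ → Ax ∣ Γ ⊢ φ
  ⇒-intro : ∀ {φ ψ} → Ax ∣ φ ∷ Γ ⊢ ψ → Ax ∣ Γ ⊢ (φ ⇒ ψ)
  ⇒-elim  : ∀ {φ ψ} → Ax ∣ Γ ⊢ (φ ⇒ ψ) → Ax ∣ Γ ⊢ φ → Ax ∣ Γ ⊢ ψ
  ∧-intro : ∀ {φ ψ} → Ax ∣ Γ ⊢ φ → Ax ∣ Γ ⊢ ψ → Ax ∣ Γ ⊢ (φ ∧ ψ)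
  ∧-elim₁ : ∀ {φ ψ} → Ax ∣ Γ ⊢ (φ ∧ ψ) → Ax ∣ Γ ⊢ φ
  ∧-elim₂ : ∀ {φ ψ} → Ax ∣ Γ ⊢ (φ ∧ ψ) → Ax ∣ Γ ⊢ ψ
  ∨-intro₁ : ∀ {φ ψ} → Ax ∣ Γ ⊢ φ → Ax ∣ Γ ⊢ (φ ∨ ψ)
  ∨-intro₂ : ∀ {φ ψ} → Ax ∣ Γ ⊢ ψ → Ax ∣ Γ ⊢ (φ ∨ ψ)
  ∨-elim  : ∀ {φ ψ χ} → Ax ∣ Γ ⊢ (φ ∨ ψ) →
            Ax ∣ φ ∷ Γ ⊢ χ → Ax ∣ ψ ∷ Γ ⊢ χ → Ax ∣ Γ ⊢ χ
  ∀-intro : ∀ {φ} → Ax ∣ map wk Γ ⊢ φ → Ax ∣ Γ ⊢ (∀̇ φ)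
  ∀-elim  : ∀ {φ} → Ax ∣ Γ ⊢ (∀̇ φ) → ∀ t → Ax ∣ Γ ⊢ (φ [ t ])
  ∃-intro : ∀ {φ} t → Ax ∣ Γ ⊢ (φ [ t ]) → Ax ∣ Γ ⊢ (∃̇ φ)
  ∃-elim  : ∀ {φ ψ} → Ax ∣ Γ ⊢ (∃̇ φ) → Ax ∣ φ ∷ map wk Γ ⊢ wk ψ → Ax ∣ Γ ⊢ ψ
  ≐-refl  : ∀ {t} → Ax ∣ Γ ⊢ (t ≐ t)
  ≐-subst : ∀ φ {s t} → Ax ∣ Γ ⊢ (s ≐ t) → Ax ∣ Γ ⊢ (φ [ s ]) → Ax ∣ Γ ⊢ (φ [ t ])

_⊢_ : Theory C → Sentence C → Set
Ax ⊢ φ = Ax ∣ [] ⊢ φ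

-- Explicit definitions of new set constants N by formulas over the old
-- set constants C.
data _+Definitions_ {C N : Set} (Ax : Theory C) (δ : N → Formula C 1) :
                    Theory (C ⊎ N) where
  old    : ∀ {φ} → Ax φ → (Ax +Definitions δ) (mapConst inj₁ φ)
  define : ∀ f → (Ax +Definitions δ) (∀̇ (v₀ ∈ inj₂ f ⇔ mapConst inj₁ (δ f)))

-- Theories are identified when they have the same theorems.
IsExtensionByDefinitionsOf : Theory (C ⊎ N) → Theory C → Set
IsExtensionByDefinitionsOf {C} {N} Ax′ Ax =
  Σ[ δ ∈ (N → Formula C 1) ]
    (∀ (φ : Sentence (C ⊎ N)) → (Ax +Definitions δ ⊢ φ) ⟺ (Ax′ ⊢ φ))

------------------------------------------------------------------------
-- Arithmetic

-- Free variables of matrices placed under a closure; no definition below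
-- uses them under a further quantifier.
private
  x : Term (suc n)
  x = v₀
  y : Term (suc (suc n))
  y = v₁
  z : Term (suc (suc (suc n)))
  z = v₂
  w : Term (suc (suc (suc (suc n))))
  w = v₃

data BASIC {C : Set} : Theory C where
  S≠0      : BASIC (closure 1 (¬ (S x ≐ 𝟎)))
  S-inj    : BASIC (closure 2 (S x ≐ S y ⇒ x ≐ y))
  +-zero   : BASIC (closure 1 (x + 𝟎 ≐ x))
  +-suc    : BASIC (closure 2 (x + S y ≐ S (x + y)))
  ·-zero   : BASIC (closure 1 (x · 𝟎 ≐ 𝟎))
  ·-suc    : BASIC (closure 2 (x · S y ≐ x · y + x))
  ≮0       : BASIC (closure 1 (¬ (x < 𝟎)))
  <-suc    : BASIC (closure 2 (x < S y ⇔ x < y ∨ x ≐ y))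
  <-cmp    : BASIC (closure 2 (x < y ∨ x ≐ y ∨ y < x))
  pred     : BASIC (closure 1 (𝟎 < v₀ ⇒ ∃<[ v₀ ] (S v₀ ≐ v₁)))
  pair-def : BASIC (closure 3
               (⟪ x , y ⟫ ≐ z ⇔ 𝟐 · z ≐ (x + y) · (x + y + 𝟏) + 𝟐 · x + 𝟐))
  pair-inj : BASIC (closure 4 (⟪ x , y ⟫ ≐ ⟪ z , w ⟫ ⇒ x ≐ z ∧ y ≐ w))
  unpair   : BASIC (closure 1
               (𝟎 < v₀ ⇒ ∃<[ v₀ ] ∃<[ v₁ ] (⟪ v₁ , v₀ ⟫ ≐ v₂)))
  H-pair   : BASIC (closure 2 (H ⟪ x , y ⟫ ≐ x))
  H-zero   : BASIC (H 𝟎 ≐ 𝟎)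
  T-pair   : BASIC (closure 2 (T ⟪ x , y ⟫ ≐ y))
  T-zero   : BASIC (T 𝟎 ≐ 𝟎)

-- The variables of φ other than index 0 are parameters.
induction : Formula C (suc n) → Sentence C
induction {n = n} φ =
  closure n (φ [ 𝟎 ] ∧ (∀̇ (φ ⇒ replace₀ (v₀ + 𝟏) φ)) ⇒ ∀̇ φ)

data IΔ⁰₀ (C : Set) : Theory C where
  basic : ∀ {φ} → BASIC φ → IΔ⁰₀ C φ
  ind   : ∀ {n} {φ : Formula C (suc n)} → Bounded φ → IΔ⁰₀ C (induction φ)

------------------------------------------------------------------------
-- Operators and derivations

_∈𝓕 : C → Sentence C
f ∈𝓕 = (∀̇ ∃̇ (⟪ v₁ , v₀ ⟫ ∈ f))
     ∧ (∀̇ ∀̇ ∀̇ (⟪ v₂ , v₁ ⟫ ∈ f ∧ ⟪ v₂ , v₀ ⟫ ∈ f ⇒ v₁ ≐ v₀))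
     ∧ 𝟎 ∉ f

data Operator : ℕ → Set where
  S ⊕ ⊗ <⋆ I D : Operator 0
  P ∘          : Operator 2
  μ            : Operator 1

infix 6 _≔_⟨_⟩ _≔-oracle_

_≔_⟨_⟩ : C → Operator n → Vec C n → Sentence C
f ≔ S  ⟨ [] ⟩ = closure 1 (f ⟨ x ⟩≐ S x)
f ≔ ⊕  ⟨ [] ⟩ = closure 2 (f ⟨ ⟪ x , y ⟫ ⟩≐ (x + y) ∧ f ⟨ 𝟎 ⟩≐ 𝟎)
f ≔ ⊗  ⟨ [] ⟩ = closure 2 (f ⟨ ⟪ x , y ⟫ ⟩≐ (x · y) ∧ f ⟨ 𝟎 ⟩≐ 𝟎)
f ≔ <⋆ ⟨ [] ⟩ = closure 2
  ( (x < y ⇒ f ⟨ ⟪ x , y ⟫ ⟩≐ 𝟏)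
  ∧ (y ≤ x ⇒ f ⟨ ⟪ x , y ⟫ ⟩≐ 𝟎)
  ∧ f ⟨ 𝟎 ⟩≐ 𝟎)
f ≔ I  ⟨ [] ⟩ = closure 1 (f ⟨ x ⟩≐ x)
f ≔ D  ⟨ [] ⟩ = closure 3
  ( f ⟨ ⟪ 𝟎 , ⟪ y , z ⟫ ⟫ ⟩≐ y
  ∧ f ⟨ ⟪ S x , ⟪ y , z ⟫ ⟫ ⟩≐ z
  ∧ f ⟨ 𝟎 ⟩≐ 𝟎
  ∧ f ⟨ ⟪ x , 𝟎 ⟫ ⟩≐ 𝟎)
f ≔ P  ⟨ g ∷ h ∷ [] ⟩ = closure 3
  (let v = y ; w = z in
   g ⟨ x ⟩≐ v ∧ h ⟨ x ⟩≐ w ⇒ f ⟨ x ⟩≐ ⟪ v , w ⟫)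
f ≔ ∘  ⟨ g ∷ h ∷ [] ⟩ = closure 3
  (h ⟨ x ⟩≐ z ∧ g ⟨ z ⟩≐ y ⇒ f ⟨ x ⟩≐ y)
f ≔ μ  ⟨ g ∷ [] ⟩ = closure 4
  (let b = w in
    (f ⟨ ⟪ b , x ⟫ ⟩≐ z ⇒ z ≤ b)
  ∧ (f ⟨ ⟪ b , x ⟫ ⟩≐ z ∧ y < b ∧ g ⟨ ⟪ y , x ⟫ ⟩≐ 𝟏 ⇒ z ≤ y)
  ∧ (f ⟨ ⟪ b , x ⟫ ⟩≐ z ∧ z < b ⇒ g ⟨ ⟪ z , x ⟫ ⟩≐ 𝟏)
  ∧ f ⟨ 𝟎 ⟩≐ 𝟎)

_≔-oracle_ : C → C → Sentence C
f ≔-oracle X = ∀̇ ((v₀ ∈ X ⇒ f ⟨ v₀ ⟩≐ 𝟏) ∧ (v₀ ∉ X ⇒ f ⟨ v₀ ⟩≐ 𝟎))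

data Derivation : Set where
  X⋆ : Derivation
  op : ∀ {n} → Operator n → Vec Derivation n → Derivation

-- L₁(X) has the one set constant tt : ⊤; L₁(X, f⃗) adds one for each
-- derivation.
SetConst : Set
SetConst = ⊤ ⊎ Derivation

pattern 𝐗   = inj₁ tt
pattern 𝐟 d = inj₂ d

data ΔRA₁ : Theory SetConst where
  basic       : ∀ {φ} → BASIC φ → ΔRA₁ φ
  oracle      : ΔRA₁ (𝐟 X⋆ ≔-oracle 𝐗)
  oracle-∈𝓕   : ΔRA₁ (𝐟 X⋆ ∈𝓕)
  operator    : ∀ {n} (o : Operator n) (ds : Vec Derivation n) →
                ΔRA₁ (𝐟 (op o ds) ≔ o ⟨ Vec.map inj₂ ds ⟩)
  operator-∈𝓕 : ∀ {n} (o : Operator n) (ds : Vec Derivation n) →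
                ΔRA₁ (𝐟 (op o ds) ∈𝓕)

{-# OPTIONS --safe #-}
module Submission where

-- Induction in ΔRA₁ comes from bounded minimization.  Pairing, projections,
-- definition by cases and the characteristic function of < generate, by
-- composition, a function deciding each propositional combination of atoms
-- at the coded sequence of its variables; a bounded quantifier is decided by
-- comparing the result of μ with its search bound.  Hence each bounded φ has
-- a characteristic function (formula-decides).  If φ(0) held and φ passed
-- from y to y + 1 while φ(b) failed, μ would find the least counterexample
-- up to b, and the predecessor of that counterexample would refute the step
-- (least-counterexample).  The only fact about order that this takes beyond
-- BASIC is asymmetry, which holds because the characteristic function of <
-- is single-valued.
--
-- The rest of the argument is the same in every theory with BASIC and
-- induction for bounded formulas of the full language (Graphs).  There the
-- graph of the function of a derivation is described by a bounded formula in
-- the functions of its immediate subderivations (graph); the search for the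
-- intermediate value of a composition is limited by a monotone polynomial
-- bound on the inner function (bound).  By bounded induction these
-- graphs are total and single-valued, respect the polynomial bounds, and are
-- equivalent to the operator axioms (graph⇒law and law⇒graph).
--
-- ΔRA₁ is such a theory by the first paragraph, which gives the bounds.
-- Unwinding the graphs recursively yields explicit bounded definitions
-- in the language with X alone (definition), which ΔRA₁ proves.  Conversely,
-- the extension of the inductive theory by these definitions has induction
-- for bounded formulas with functions, because the functions can be
-- eliminated from such a formula without losing boundedness
-- (Extended-induction); so it proves the operator axioms.

open import Defs
open import Data.Fin.Base using (Fin; zero; suc)
open import Data.List.Base using (List; []; _∷_; map)
open import Data.List.Membership.Propositional using () renaming (_∈_ to _∈ˡ_)
open import Data.List.Membership.Propositional.Properties using (∈-map⁺; ∈-map⁻)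
open import Data.List.Relation.Unary.All using (All; []; _∷_)
open import Data.List.Relation.Unary.Any using (here; there)
open import Data.Nat.Base using (ℕ; zero; suc)
open import Data.Product.Base using (_×_; Σ-syntax; _,_; proj₁; proj₂)
open import Data.Sum.Base as Sum using (_⊎_; inj₁; inj₂)
open import Data.Unit.Base using (⊤; tt)
open import Data.Vec.Base as Vec using (Vec; []; _∷_; lookup)
open import Data.Vec.Properties using (lookup-map)
open import Function.Bundles using (mk⇔)
open import Relation.Binary.PropositionalEquality
  using (_≡_; refl; sym; trans; cong; cong₂; module ≡-Reasoning)
  renaming (subst to ≡-subst)

private
  variable
    C C′ C″   : Set
    k l m n   : ℕ

-- Substitution

-- Substitution by a vector: on a formula with concrete variables the result
-- computes, even when the terms substituted are abstract.
infixl 9 _⟦_⟧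

_⟦_⟧ : Formula C k → Vec (Term n) k → Formula C n
φ ⟦ ts ⟧ = subst (lookup ts) φ

liftˢ-cong : {σ τ : Fin m → Term n} → (∀ i → σ i ≡ τ i) →
             ∀ i → liftˢ σ i ≡ liftˢ τ i
liftˢ-cong σ≡τ zero    = refl
liftˢ-cong σ≡τ (suc i) = cong wkᵗ (σ≡τ i)

substᵗ-cong : {σ τ : Fin m → Term n} → (∀ i → σ i ≡ τ i) →
              ∀ t → substᵗ σ t ≡ substᵗ τ t
substᵗ-cong e (var i)   = e i
substᵗ-cong e 𝟎         = refl
substᵗ-cong e (S t)     = cong S (substᵗ-cong e t)
substᵗ-cong e (H t)     = cong H (substᵗ-cong e t)
substᵗ-cong e (T t)     = cong T (substᵗ-cong e t)
substᵗ-cong e (s + t)   = cong₂ _+_ (substᵗ-cong e s) (substᵗ-cong e t)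
substᵗ-cong e (s · t)   = cong₂ _·_ (substᵗ-cong e s) (substᵗ-cong e t)
substᵗ-cong e ⟪ s , t ⟫ = cong₂ ⟪_,_⟫ (substᵗ-cong e s) (substᵗ-cong e t)

subst-cong : {σ τ : Fin m → Term n} → (∀ i → σ i ≡ τ i) →
             (φ : Formula C m) → subst σ φ ≡ subst τ φ
subst-cong e (s ≐ t) = cong₂ _≐_ (substᵗ-cong e s) (substᵗ-cong e t)
subst-cong e (s < t) = cong₂ _<_ (substᵗ-cong e s) (substᵗ-cong e t)
subst-cong e (t ∈ f) = cong (_∈ f) (substᵗ-cong e t)
subst-cong e ⊥       = refl
subst-cong e (φ ⇒ ψ) = cong₂ _⇒_ (subst-cong e φ) (subst-cong e ψ)
subst-cong e (φ ∧ ψ) = cong₂ _∧_ (subst-cong e φ) (subst-cong e ψ)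
subst-cong e (φ ∨ ψ) = cong₂ _∨_ (subst-cong e φ) (subst-cong e ψ)
subst-cong e (∀̇ φ)   = cong ∀̇_ (subst-cong (liftˢ-cong e) φ)
subst-cong e (∃̇ φ)   = cong ∃̇_ (subst-cong (liftˢ-cong e) φ)

renameᵗ≡substᵗ : (ρ : Fin m → Fin n) → ∀ t →
                 renameᵗ ρ t ≡ substᵗ (λ i → var (ρ i)) t
renameᵗ≡substᵗ ρ (var i)   = refl
renameᵗ≡substᵗ ρ 𝟎         = refl
renameᵗ≡substᵗ ρ (S t)     = cong S (renameᵗ≡substᵗ ρ t)
renameᵗ≡substᵗ ρ (H t)     = cong H (renameᵗ≡substᵗ ρ t)
renameᵗ≡substᵗ ρ (T t)     = cong T (renameᵗ≡substᵗ ρ t)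
renameᵗ≡substᵗ ρ (s + t)   = cong₂ _+_ (renameᵗ≡substᵗ ρ s) (renameᵗ≡substᵗ ρ t)
renameᵗ≡substᵗ ρ (s · t)   = cong₂ _·_ (renameᵗ≡substᵗ ρ s) (renameᵗ≡substᵗ ρ t)
renameᵗ≡substᵗ ρ ⟪ s , t ⟫ = cong₂ ⟪_,_⟫ (renameᵗ≡substᵗ ρ s) (renameᵗ≡substᵗ ρ t)

substᵗ-substᵗ : (τ : Fin m → Term n) (σ : Fin k → Term m) → ∀ t →
                substᵗ τ (substᵗ σ t) ≡ substᵗ (λ i → substᵗ τ (σ i)) t
substᵗ-substᵗ τ σ (var i)   = refl
substᵗ-substᵗ τ σ 𝟎         = refl
substᵗ-substᵗ τ σ (S t)     = cong S (substᵗ-substᵗ τ σ t)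
substᵗ-substᵗ τ σ (H t)     = cong H (substᵗ-substᵗ τ σ t)
substᵗ-substᵗ τ σ (T t)     = cong T (substᵗ-substᵗ τ σ t)
substᵗ-substᵗ τ σ (s + t)   = cong₂ _+_ (substᵗ-substᵗ τ σ s) (substᵗ-substᵗ τ σ t)
substᵗ-substᵗ τ σ (s · t)   = cong₂ _·_ (substᵗ-substᵗ τ σ s) (substᵗ-substᵗ τ σ t)
substᵗ-substᵗ τ σ ⟪ s , t ⟫ = cong₂ ⟪_,_⟫ (substᵗ-substᵗ τ σ s) (substᵗ-substᵗ τ σ t)

substᵗ-wkᵗ : (τ : Fin (suc m) → Term n) → ∀ t →
             substᵗ τ (wkᵗ t) ≡ substᵗ (λ i → τ (suc i)) t
substᵗ-wkᵗ τ t = trans (cong (substᵗ τ) (renameᵗ≡substᵗ suc t))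
                       (substᵗ-substᵗ τ _ t)

substᵗ-liftˢ-wkᵗ : (σ : Fin m → Term n) → ∀ t →
                   substᵗ (liftˢ σ) (wkᵗ t) ≡ wkᵗ (substᵗ σ t)
substᵗ-liftˢ-wkᵗ σ t = begin
  substᵗ (liftˢ σ) (wkᵗ t)
    ≡⟨ substᵗ-wkᵗ (liftˢ σ) t ⟩
  substᵗ (λ i → wkᵗ (σ i)) t
    ≡⟨ substᵗ-cong (λ i → renameᵗ≡substᵗ suc (σ i)) t ⟩
  substᵗ (λ i → substᵗ (λ j → var (suc j)) (σ i)) t
    ≡⟨ substᵗ-substᵗ _ σ t ⟨
  substᵗ (λ j → var (suc j)) (substᵗ σ t)
    ≡⟨ renameᵗ≡substᵗ suc (substᵗ σ t) ⟨
  wkᵗ (substᵗ σ t) ∎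
  where open ≡-Reasoning

liftˢ-substᵗ : (τ : Fin m → Term n) (σ : Fin k → Term m) → ∀ i →
               substᵗ (liftˢ τ) (liftˢ σ i) ≡ liftˢ (λ j → substᵗ τ (σ j)) i
liftˢ-substᵗ τ σ zero    = refl
liftˢ-substᵗ τ σ (suc i) = substᵗ-liftˢ-wkᵗ τ (σ i)

subst-subst : (τ : Fin m → Term n) (σ : Fin k → Term m) (φ : Formula C k) →
              subst τ (subst σ φ) ≡ subst (λ i → substᵗ τ (σ i)) φ
subst-subst τ σ (s ≐ t) = cong₂ _≐_ (substᵗ-substᵗ τ σ s) (substᵗ-substᵗ τ σ t)
subst-subst τ σ (s < t) = cong₂ _<_ (substᵗ-substᵗ τ σ s) (substᵗ-substᵗ τ σ t)
subst-subst τ σ (t ∈ f) = cong (_∈ f) (substᵗ-substᵗ τ σ t)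
subst-subst τ σ ⊥       = refl
subst-subst τ σ (φ ⇒ ψ) = cong₂ _⇒_ (subst-subst τ σ φ) (subst-subst τ σ ψ)
subst-subst τ σ (φ ∧ ψ) = cong₂ _∧_ (subst-subst τ σ φ) (subst-subst τ σ ψ)
subst-subst τ σ (φ ∨ ψ) = cong₂ _∨_ (subst-subst τ σ φ) (subst-subst τ σ ψ)
subst-subst τ σ (∀̇ φ)   = cong ∀̇_ (trans (subst-subst (liftˢ τ) (liftˢ σ) φ)
                                         (subst-cong (liftˢ-substᵗ τ σ) φ))
subst-subst τ σ (∃̇ φ)   = cong ∃̇_ (trans (subst-subst (liftˢ τ) (liftˢ σ) φ)
                                         (subst-cong (liftˢ-substᵗ τ σ) φ))

substᵗ-id : {σ : Fin n → Term n} → (∀ i → σ i ≡ var i) → ∀ t → substᵗ σ t ≡ t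
substᵗ-id e (var i)   = e i
substᵗ-id e 𝟎         = refl
substᵗ-id e (S t)     = cong S (substᵗ-id e t)
substᵗ-id e (H t)     = cong H (substᵗ-id e t)
substᵗ-id e (T t)     = cong T (substᵗ-id e t)
substᵗ-id e (s + t)   = cong₂ _+_ (substᵗ-id e s) (substᵗ-id e t)
substᵗ-id e (s · t)   = cong₂ _·_ (substᵗ-id e s) (substᵗ-id e t)
substᵗ-id e ⟪ s , t ⟫ = cong₂ ⟪_,_⟫ (substᵗ-id e s) (substᵗ-id e t)

liftˢ-id : {σ : Fin n → Term n} → (∀ i → σ i ≡ var i) →
           ∀ i → liftˢ σ i ≡ var i
liftˢ-id e zero    = refl
liftˢ-id e (suc i) = cong wkᵗ (e i)

subst-id : {σ : Fin n → Term n} → (∀ i → σ i ≡ var i) →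
           (φ : Formula C n) → subst σ φ ≡ φ
subst-id e (s ≐ t) = cong₂ _≐_ (substᵗ-id e s) (substᵗ-id e t)
subst-id e (s < t) = cong₂ _<_ (substᵗ-id e s) (substᵗ-id e t)
subst-id e (t ∈ f) = cong (_∈ f) (substᵗ-id e t)
subst-id e ⊥       = refl
subst-id e (φ ⇒ ψ) = cong₂ _⇒_ (subst-id e φ) (subst-id e ψ)
subst-id e (φ ∧ ψ) = cong₂ _∧_ (subst-id e φ) (subst-id e ψ)
subst-id e (φ ∨ ψ) = cong₂ _∨_ (subst-id e φ) (subst-id e ψ)
subst-id e (∀̇ φ)   = cong ∀̇_ (subst-id (liftˢ-id e) φ)
subst-id e (∃̇ φ)   = cong ∃̇_ (subst-id (liftˢ-id e) φ)

subst-square : {σ : Fin k → Term m} {τ : Fin m → Term n}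
               {σ′ : Fin k → Term l} {τ′ : Fin l → Term n} →
               (∀ i → substᵗ τ (σ i) ≡ substᵗ τ′ (σ′ i)) →
               (φ : Formula C k) → subst τ (subst σ φ) ≡ subst τ′ (subst σ′ φ)
subst-square {σ = σ} {τ} {σ′} {τ′} e φ = begin
  subst τ (subst σ φ)              ≡⟨ subst-subst τ σ φ ⟩
  subst (λ i → substᵗ τ (σ i)) φ   ≡⟨ subst-cong e φ ⟩
  subst (λ i → substᵗ τ′ (σ′ i)) φ ≡⟨ subst-subst τ′ σ′ φ ⟨
  subst τ′ (subst σ′ φ)            ∎
  where open ≡-Reasoning

substᵗ-instantiate-wkᵗ : (s t : Term n) → substᵗ (instantiate s) (wkᵗ t) ≡ t
substᵗ-instantiate-wkᵗ s t = trans (substᵗ-wkᵗ (instantiate s) t)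
                                   (substᵗ-id (λ _ → refl) t)

substᵗ-update-wkᵗ : (s : Term (suc n)) (t : Term n) →
                    substᵗ (update s) (wkᵗ t) ≡ wkᵗ t
substᵗ-update-wkᵗ s t = trans (substᵗ-wkᵗ (update s) t)
                              (sym (renameᵗ≡substᵗ suc t))

subst-[] : (σ : Fin m → Term n) (φ : Formula C (suc m)) (t : Term m) →
           subst (liftˢ σ) φ [ substᵗ σ t ] ≡ subst σ (φ [ t ])
subst-[] σ φ t = subst-square
  (λ { zero → refl ; (suc i) → substᵗ-instantiate-wkᵗ _ (σ i) }) φ

subst-wk : (σ : Fin m → Term n) (φ : Formula C m) →
           subst (liftˢ σ) (wk φ) ≡ wk (subst σ φ)
subst-wk σ = subst-square (λ i → renameᵗ≡substᵗ suc (σ i))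

weaken₀-subst : (σ : Fin m → Term n) (φ : Sentence C) →
                subst σ (weaken₀ φ) ≡ weaken₀ φ
weaken₀-subst σ φ = trans (subst-subst σ _ φ) (subst-cong (λ ()) φ)

bounded-subst : {σ : Fin m → Term n} {φ : Formula C m} →
                Bounded φ → Bounded (subst σ φ)
bounded-subst (s ≐ t) = _ ≐ _
bounded-subst (s < t) = _ < _
bounded-subst (t ∈ f) = _ ∈ _
bounded-subst ⊥       = ⊥
bounded-subst (b ⇒ c) = bounded-subst b ⇒ bounded-subst c
bounded-subst (b ∧ c) = bounded-subst b ∧ bounded-subst c
bounded-subst (b ∨ c) = bounded-subst b ∨ bounded-subst c
bounded-subst {σ = σ} (all t b) rewrite substᵗ-liftˢ-wkᵗ σ t =
  all (substᵗ σ t) (bounded-subst b)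
bounded-subst {σ = σ} (ex t b)  rewrite substᵗ-liftˢ-wkᵗ σ t =
  ex (substᵗ σ t) (bounded-subst b)

-- Derivations under substitution, weakening and change of theory

along : {Ax : Theory C} {Γ : List (Formula C n)} {φ ψ : Formula C n} →
        φ ≡ ψ → Ax ∣ Γ ⊢ φ → Ax ∣ Γ ⊢ ψ
along refl p = p

-- Stated in every context, since an axiom can occur anywhere in a derivation.
_⊑_ : Theory C → Theory C → Set
Ax ⊑ Ax′ = ∀ {φ n} {Γ : List (Formula _ n)} → Ax φ → Ax′ ∣ Γ ⊢ weaken₀ φ

module _ {Ax Ax′ : Theory C} (⊑ : Ax ⊑ Ax′) where

  -- Substitution, weakening and change of theory take the same induction on
  -- derivations, so one statement covers the three.
  transfer : {σ : Fin m → Term n} {Γ : List (Formula C m)} {Δ : List (Formula C n)} →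
             (∀ {ψ} → ψ ∈ˡ Γ → subst σ ψ ∈ˡ Δ) →
             ∀ {φ} → Ax ∣ Γ ⊢ φ → Ax′ ∣ Δ ⊢ subst σ φ

  transfer-∷ : {σ : Fin m → Term n} {Γ : List (Formula C m)} {Δ : List (Formula C n)} →
               (∀ {ψ} → ψ ∈ˡ Γ → subst σ ψ ∈ˡ Δ) → ∀ {χ φ} →
               Ax ∣ χ ∷ Γ ⊢ φ → Ax′ ∣ subst σ χ ∷ Δ ⊢ subst σ φ
  transfer-∷ ρ = transfer λ { (here refl) → here refl ; (there i) → there (ρ i) }

  lift-context : {σ : Fin m → Term n} {Γ : List (Formula C m)} {Δ : List (Formula C n)} →
                 (∀ {ψ} → ψ ∈ˡ Γ → subst σ ψ ∈ˡ Δ) →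
                 ∀ {ψ} → ψ ∈ˡ map wk Γ → subst (liftˢ σ) ψ ∈ˡ map wk Δ
  lift-context {σ = σ} ρ i with ∈-map⁻ wk i
  ... | χ , j , refl =
    ≡-subst (_∈ˡ _) (sym (subst-wk σ χ)) (∈-map⁺ wk (ρ j))

  transfer {σ = σ} ρ (axiom {φ} a) =
    along (sym (weaken₀-subst σ φ)) (⊑ a)
  transfer ρ (hyp i)         = hyp (ρ i)
  transfer ρ (raa p)         = raa (transfer-∷ ρ p)
  transfer ρ (⇒-intro p)     = ⇒-intro (transfer-∷ ρ p)
  transfer ρ (⇒-elim p q)    = ⇒-elim (transfer ρ p) (transfer ρ q)
  transfer ρ (∧-intro p q)   = ∧-intro (transfer ρ p) (transfer ρ q)
  transfer ρ (∧-elim₁ p)     = ∧-elim₁ (transfer ρ p)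
  transfer ρ (∧-elim₂ p)     = ∧-elim₂ (transfer ρ p)
  transfer ρ (∨-intro₁ p)    = ∨-intro₁ (transfer ρ p)
  transfer ρ (∨-intro₂ p)    = ∨-intro₂ (transfer ρ p)
  transfer ρ (∨-elim p q r)  =
    ∨-elim (transfer ρ p) (transfer-∷ ρ q) (transfer-∷ ρ r)
  transfer ρ (∀-intro p)     = ∀-intro (transfer (lift-context ρ) p)
  transfer {σ = σ} ρ (∀-elim {φ} p t) =
    along (subst-[] σ φ t) (∀-elim (transfer ρ p) (substᵗ σ t))
  transfer {σ = σ} ρ (∃-intro {φ} t p) =
    ∃-intro (substᵗ σ t)
      (along (sym (subst-[] σ φ t)) (transfer ρ p))
  transfer {σ = σ} ρ (∃-elim {ψ = ψ} p q) =
    ∃-elim (transfer ρ p)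
      (along (subst-wk σ ψ) (transfer-∷ (lift-context ρ) q))
  transfer ρ ≐-refl          = ≐-refl
  transfer {σ = σ} ρ (≐-subst φ {s} {t} p q) =
    along (subst-[] σ φ t)
      (≐-subst (subst (liftˢ σ) φ) (transfer ρ p)
        (along (sym (subst-[] σ φ s)) (transfer ρ q)))

  transfer-sentence : ∀ {φ : Sentence C} → Ax ⊢ φ → Ax′ ⊢ φ
  transfer-sentence {φ} p =
    along (subst-id (λ _ → refl) φ) (transfer {σ = var} (λ ()) p)

private
  variable
    Ax Ax′    : Theory C
    Γ Δ       : List (Formula C n)
    φ φ′ ψ ψ′ χ : Formula C n
    s t u s′ t′ : Term n

pattern h₀ = hyp (here refl)
pattern h₁ = hyp (there (here refl))
pattern h₂ = hyp (there (there (here refl)))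
pattern h₃ = hyp (there (there (there (here refl))))
pattern h₄ = hyp (there (there (there (there (here refl)))))

weaken : (∀ {ψ} → ψ ∈ˡ Γ → ψ ∈ˡ Δ) → Ax ∣ Γ ⊢ φ → Ax ∣ Δ ⊢ φ
weaken {Ax = Ax} {φ = φ} Γ⊆Δ p =
  along (subst-id (λ _ → refl) φ)
    (transfer axiom
      (λ {ψ} i → ≡-subst (_∈ˡ _) (sym (subst-id (λ _ → refl) ψ)) (Γ⊆Δ i)) p)

infixl 10 ↑_

↑_ : Ax ∣ Γ ⊢ φ → Ax ∣ ψ ∷ Γ ⊢ φ
↑_ = weaken there

close : Ax ∣ [] ⊢ φ → Ax ∣ Γ ⊢ φ
close = weaken λ ()

⇑ : Ax ∣ Γ ⊢ φ → Ax ∣ map wk Γ ⊢ wk φ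
⇑ = transfer axiom (∈-map⁺ wk)

-- A derivation in variables serves as a derived rule: its hypotheses
-- become the premises, at any terms and in any context.
apply : {Γ : List (Formula C n)} {Δ : List (Formula C k)} {φ : Formula C k} →
        Ax ∣ Δ ⊢ φ → (ts : Vec (Term n) k) →
        All (λ ψ → Ax ∣ Γ ⊢ ψ ⟦ ts ⟧) Δ → Ax ∣ Γ ⊢ φ ⟦ ts ⟧
apply {Δ = []}    p ts []       = transfer axiom (λ ()) p
apply {Δ = _ ∷ _} p ts (q ∷ qs) = ⇒-elim (apply (⇒-intro p) ts qs) q

∀-variable : {φ : Formula C (suc n)} →
             Ax ∣ Γ ⊢ (∀̇ φ) → Ax ∣ map wk Γ ⊢ φ
∀-variable {Ax = Ax} {φ = φ} p =
  along (trans (subst-subst _ _ φ)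
                        (subst-id (λ { zero → refl ; (suc _) → refl }) φ))
    (∀-elim (⇑ p) v₀)

closure-intro : ∀ n {φ : Formula C n} → Ax ∣ [] ⊢ φ → Ax ⊢ closure n φ
closure-intro zero    p = p
closure-intro (suc n) p = closure-intro n (∀-intro p)

closure-elim : ∀ n {φ : Formula C n} → Ax ⊢ closure n φ → Ax ∣ [] ⊢ φ
closure-elim zero    p = p
closure-elim (suc n) p = ∀-variable (closure-elim n p)

at : {φ : Formula C k} → Ax ⊢ closure k φ → (ts : Vec (Term n) k) →
     Ax ∣ Γ ⊢ φ ⟦ ts ⟧
at {k = k} p ts = apply (closure-elim k p) ts []

-- Propositional logic

efq : Ax ∣ Γ ⊢ ⊥ → Ax ∣ Γ ⊢ φ
efq p = raa (↑ p)

cut : Ax ∣ Γ ⊢ φ → Ax ∣ φ ∷ Γ ⊢ ψ → Ax ∣ Γ ⊢ ψ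
cut p q = ⇒-elim (⇒-intro q) p

contradiction : Ax ∣ Γ ⊢ φ → Ax ∣ Γ ⊢ (¬ φ) → Ax ∣ Γ ⊢ ψ
contradiction p q = efq (⇒-elim q p)

excluded-middle : ∀ φ → Ax ∣ Γ ⊢ (φ ∨ ¬ φ)
excluded-middle φ =
  raa (⇒-elim h₀ (∨-intro₂ (⇒-intro (⇒-elim h₁ (∨-intro₁ h₀)))))

by-cases : ∀ φ → Ax ∣ φ ∷ Γ ⊢ ψ → Ax ∣ (¬ φ) ∷ Γ ⊢ ψ → Ax ∣ Γ ⊢ ψ
by-cases φ = ∨-elim (excluded-middle φ)

⇔-intro : Ax ∣ φ ∷ Γ ⊢ ψ → Ax ∣ ψ ∷ Γ ⊢ φ → Ax ∣ Γ ⊢ (φ ⇔ ψ)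
⇔-intro p q = ∧-intro (⇒-intro p) (⇒-intro q)

forth : Ax ∣ Γ ⊢ (φ ⇔ ψ) → Ax ∣ Γ ⊢ φ → Ax ∣ Γ ⊢ ψ
forth e = ⇒-elim (∧-elim₁ e)

back : Ax ∣ Γ ⊢ (φ ⇔ ψ) → Ax ∣ Γ ⊢ ψ → Ax ∣ Γ ⊢ φ
back e = ⇒-elim (∧-elim₂ e)

⇔-refl : Ax ∣ Γ ⊢ (φ ⇔ φ)
⇔-refl = ⇔-intro h₀ h₀

⇔-sym : Ax ∣ Γ ⊢ (φ ⇔ ψ) → Ax ∣ Γ ⊢ (ψ ⇔ φ)
⇔-sym e = ∧-intro (∧-elim₂ e) (∧-elim₁ e)

⇔-trans : Ax ∣ Γ ⊢ (φ ⇔ ψ) → Ax ∣ Γ ⊢ (ψ ⇔ χ) → Ax ∣ Γ ⊢ (φ ⇔ χ)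
⇔-trans e f = ⇔-intro (forth (↑ f) (forth (↑ e) h₀)) (back (↑ e) (back (↑ f) h₀))

⇒-cong : Ax ∣ Γ ⊢ (φ ⇔ φ′) → Ax ∣ Γ ⊢ (ψ ⇔ ψ′) → Ax ∣ Γ ⊢ ((φ ⇒ ψ) ⇔ (φ′ ⇒ ψ′))
⇒-cong e f = ⇔-intro
  (⇒-intro (forth (↑ ↑ f) (⇒-elim h₁ (back (↑ ↑ e) h₀))))
  (⇒-intro (back (↑ ↑ f) (⇒-elim h₁ (forth (↑ ↑ e) h₀))))

∧-cong : Ax ∣ Γ ⊢ (φ ⇔ φ′) → Ax ∣ Γ ⊢ (ψ ⇔ ψ′) → Ax ∣ Γ ⊢ ((φ ∧ ψ) ⇔ (φ′ ∧ ψ′))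
∧-cong e f = ⇔-intro
  (∧-intro (forth (↑ e) (∧-elim₁ h₀)) (forth (↑ f) (∧-elim₂ h₀)))
  (∧-intro (back (↑ e) (∧-elim₁ h₀)) (back (↑ f) (∧-elim₂ h₀)))

∨-cong : Ax ∣ Γ ⊢ (φ ⇔ φ′) → Ax ∣ Γ ⊢ (ψ ⇔ ψ′) → Ax ∣ Γ ⊢ ((φ ∨ ψ) ⇔ (φ′ ∨ ψ′))
∨-cong e f = ⇔-intro
  (∨-elim h₀ (∨-intro₁ (forth (↑ ↑ e) h₀)) (∨-intro₂ (forth (↑ ↑ f) h₀)))
  (∨-elim h₀ (∨-intro₁ (back (↑ ↑ e) h₀)) (∨-intro₂ (back (↑ ↑ f) h₀)))

∀-mono : Ax ∣ φ ∷ map wk Γ ⊢ ψ → Ax ∣ Γ ⊢ (∀̇ φ) → Ax ∣ Γ ⊢ (∀̇ ψ)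
∀-mono p q = ∀-intro (cut (∀-variable q) p)

∃-variable : {φ : Formula C (suc n)} {Γ : List (Formula C (suc n))} →
             Ax ∣ Γ ⊢ φ → Ax ∣ Γ ⊢ wk (∃̇ φ)
∃-variable {Ax = Ax} {φ = φ} p =
  ∃-intro v₀ (along
    (sym (trans (subst-subst _ _ φ)
           (subst-id (λ { zero → refl ; (suc _) → refl }) φ))) p)

∃-mono : Ax ∣ φ ∷ map wk Γ ⊢ ψ → Ax ∣ Γ ⊢ (∃̇ φ) → Ax ∣ Γ ⊢ (∃̇ ψ)
∃-mono p q = ∃-elim q (∃-variable p)

∀-cong : Ax ∣ map wk Γ ⊢ (φ ⇔ ψ) → Ax ∣ Γ ⊢ ((∀̇ φ) ⇔ (∀̇ ψ))
∀-cong e = ⇔-intro (∀-mono (forth (weaken (λ i → there (there i)) e) h₀) h₀)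
                   (∀-mono (back (weaken (λ i → there (there i)) e) h₀) h₀)

∃-cong : Ax ∣ map wk Γ ⊢ (φ ⇔ ψ) → Ax ∣ Γ ⊢ ((∃̇ φ) ⇔ (∃̇ ψ))
∃-cong e = ⇔-intro (∃-mono (forth (weaken (λ i → there (there i)) e) h₀) h₀)
                   (∃-mono (back (weaken (λ i → there (there i)) e) h₀) h₀)

-- Equality

-- Index 0 of φ marks the place where s is replaced by t.
rewriting : (φ : Formula C (suc k)) (ts : Vec (Term n) k) →
            Ax ∣ Γ ⊢ (s ≐ t) → Ax ∣ Γ ⊢ φ ⟦ s ∷ ts ⟧ → Ax ∣ Γ ⊢ φ ⟦ t ∷ ts ⟧
rewriting {Ax = Ax} φ ts p q =
  along (hole _) (≐-subst φ◌ p (along (sym (hole _)) q))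
  where
  φ◌ = φ ⟦ v₀ ∷ Vec.map wkᵗ ts ⟧
  hole : ∀ r → φ◌ [ r ] ≡ φ ⟦ r ∷ ts ⟧
  hole r = trans (subst-subst _ _ φ) (subst-cong (λ
    { zero    → refl
    ; (suc i) → trans (cong (substᵗ _) (lookup-map i wkᵗ ts))
                      (substᵗ-instantiate-wkᵗ r (lookup ts i)) }) φ)

≐-sym : Ax ∣ Γ ⊢ (s ≐ t) → Ax ∣ Γ ⊢ (t ≐ s)
≐-sym {s = s} p = rewriting (v₀ ≐ v₁) (s ∷ []) p ≐-refl

≐-trans : Ax ∣ Γ ⊢ (s ≐ t) → Ax ∣ Γ ⊢ (t ≐ u) → Ax ∣ Γ ⊢ (s ≐ u)
≐-trans {s = s} p q = rewriting (v₁ ≐ v₀) (s ∷ []) q p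

∈-cong : {f : C} → Ax ∣ Γ ⊢ (s ≐ t) → Ax ∣ Γ ⊢ (s ∈ f) → Ax ∣ Γ ⊢ (t ∈ f)
∈-cong {f = f} = rewriting (v₀ ∈ f) []

<-cong : Ax ∣ Γ ⊢ (s ≐ s′) → Ax ∣ Γ ⊢ (t ≐ t′) → Ax ∣ Γ ⊢ (s < t) → Ax ∣ Γ ⊢ (s′ < t′)
<-cong p q r = rewriting (v₁ < v₀) (_ ∷ []) q (rewriting (v₀ < v₁) (_ ∷ []) p r)

≤-cong : Ax ∣ Γ ⊢ (s ≐ s′) → Ax ∣ Γ ⊢ (t ≐ t′) → Ax ∣ Γ ⊢ (s ≤ t) → Ax ∣ Γ ⊢ (s′ ≤ t′)
≤-cong p q r = rewriting (v₁ ≤ v₀) (_ ∷ []) q (rewriting (v₀ ≤ v₁) (_ ∷ []) p r)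

S-cong : Ax ∣ Γ ⊢ (s ≐ t) → Ax ∣ Γ ⊢ (S s ≐ S t)
S-cong p = rewriting (S v₁ ≐ S v₀) (_ ∷ []) p ≐-refl

H-cong : Ax ∣ Γ ⊢ (s ≐ t) → Ax ∣ Γ ⊢ (H s ≐ H t)
H-cong p = rewriting (H v₁ ≐ H v₀) (_ ∷ []) p ≐-refl

T-cong : Ax ∣ Γ ⊢ (s ≐ t) → Ax ∣ Γ ⊢ (T s ≐ T t)
T-cong p = rewriting (T v₁ ≐ T v₀) (_ ∷ []) p ≐-refl

+-cong : Ax ∣ Γ ⊢ (s ≐ s′) → Ax ∣ Γ ⊢ (t ≐ t′) → Ax ∣ Γ ⊢ ((s + t) ≐ (s′ + t′))
+-cong p q = rewriting (v₁ + v₂ ≐ v₃ + v₀) (_ ∷ _ ∷ _ ∷ []) q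
              (rewriting (v₁ + v₂ ≐ v₀ + v₂) (_ ∷ _ ∷ []) p ≐-refl)

·-cong : Ax ∣ Γ ⊢ (s ≐ s′) → Ax ∣ Γ ⊢ (t ≐ t′) → Ax ∣ Γ ⊢ ((s · t) ≐ (s′ · t′))
·-cong p q = rewriting (v₁ · v₂ ≐ v₃ · v₀) (_ ∷ _ ∷ _ ∷ []) q
              (rewriting (v₁ · v₂ ≐ v₀ · v₂) (_ ∷ _ ∷ []) p ≐-refl)

⟪⟫-cong : Ax ∣ Γ ⊢ (s ≐ s′) → Ax ∣ Γ ⊢ (t ≐ t′) → Ax ∣ Γ ⊢ (⟪ s , t ⟫ ≐ ⟪ s′ , t′ ⟫)
⟪⟫-cong p q = rewriting (⟪ v₁ , v₂ ⟫ ≐ ⟪ v₃ , v₀ ⟫) (_ ∷ _ ∷ _ ∷ []) q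
               (rewriting (⟪ v₁ , v₂ ⟫ ≐ ⟪ v₀ , v₂ ⟫) (_ ∷ _ ∷ []) p ≐-refl)

value-cong : {f : C} → Ax ∣ Γ ⊢ (s ≐ s′) → Ax ∣ Γ ⊢ (t ≐ t′) →
             Ax ∣ Γ ⊢ f ⟨ s ⟩≐ t → Ax ∣ Γ ⊢ f ⟨ s′ ⟩≐ t′
value-cong p q = ∈-cong (⟪⟫-cong p q)

-- Induction

-- The open form of the induction principle for φ.
progressive⇒all : Formula C (suc n) → Formula C n
progressive⇒all φ = φ [ 𝟎 ] ∧ (∀̇ (φ ⇒ replace₀ (v₀ + 𝟏) φ)) ⇒ ∀̇ φ

-- This transports induction to φ from an equivalent formula of special form:
-- one about a characteristic function, or one without functions.
progressive⇒all-cong : {φ ψ : Formula C (suc n)} → Ax ∣ [] ⊢ (φ ⇔ ψ) →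
                 Ax ∣ [] ⊢ progressive⇒all ψ → Ax ∣ [] ⊢ progressive⇒all φ
progressive⇒all-cong e p = ⇒-intro (∀-mono (back (close e) h₀)
  (⇒-elim (↑ p) (∧-intro
    (forth (transfer axiom (λ ()) e) (∧-elim₁ h₀))
    (∀-mono (forth (⇒-cong (close e) (transfer axiom (λ ()) e)) h₀)
            (∧-elim₂ h₀)))))

-- Consequences of BASIC

module Basic {Ax : Theory C} (basic : ∀ {φ} → BASIC φ → Ax ⊢ φ) where

  private
    infix 0 _⊩_
    _⊩_ : List (Formula C n) → Formula C n → Set
    _⊩_ = Ax ∣_⊢_

  S≢0 : Γ ⊩ S s ≐ 𝟎 → Γ ⊩ χ
  S≢0 {s = s} p = contradiction p (at (basic S≠0) (s ∷ []))

  +0 : Γ ⊩ s + 𝟎 ≐ s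
  +0 {s = s} = at (basic +-zero) (s ∷ [])

  +S : Γ ⊩ s + S t ≐ S (s + t)
  +S {s = s} {t = t} = at (basic +-suc) (s ∷ t ∷ [])

  +1 : Γ ⊩ s + 𝟏 ≐ S s
  +1 = ≐-trans +S (S-cong +0)

  ·0 : Γ ⊩ s · 𝟎 ≐ 𝟎
  ·0 {s = s} = at (basic ·-zero) (s ∷ [])

  ·S : Γ ⊩ s · S t ≐ s · t + s
  ·S {s = s} {t = t} = at (basic ·-suc) (s ∷ t ∷ [])

  ≮𝟎 : Γ ⊩ s < 𝟎 → Γ ⊩ χ
  ≮𝟎 {s = s} p = contradiction p (at (basic ≮0) (s ∷ []))

  <S⇒≤ : Γ ⊩ s < S t → Γ ⊩ s ≤ t
  <S⇒≤ {s = s} {t = t} = forth (at (basic <-suc) (s ∷ t ∷ []))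

  ≤⇒<S : Γ ⊩ s ≤ t → Γ ⊩ s < S t
  ≤⇒<S {s = s} {t = t} = back (at (basic <-suc) (s ∷ t ∷ []))

  compare : ∀ s t → Γ ⊩ s < t ∨ s ≐ t ∨ t < s
  compare s t = at (basic <-cmp) (s ∷ t ∷ [])

  <-or-≥ : ∀ s t → Γ ⊩ s < t ∨ t ≤ s
  <-or-≥ s t = ∨-elim (compare s t) (∨-intro₁ h₀)
    (∨-elim h₀ (∨-intro₂ (∨-intro₂ (≐-sym h₀))) (∨-intro₂ (∨-intro₁ h₀)))

  n<S : Γ ⊩ s < S s
  n<S = ≤⇒<S (∨-intro₂ ≐-refl)

  0-or-positive : ∀ s → Γ ⊩ s ≐ 𝟎 ∨ 𝟎 < s
  0-or-positive s = ∨-elim (<-or-≥ 𝟎 s) (∨-intro₂ h₀)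
    (∨-elim h₀ (≮𝟎 h₀) (∨-intro₁ h₀))

  0≤ : Γ ⊩ 𝟎 ≤ s
  0≤ {s = s} = ∨-elim (0-or-positive s) (∨-intro₂ (≐-sym h₀)) (∨-intro₁ h₀)

  predecessor : Γ ⊩ 𝟎 < s → Γ ⊩ ∃<[ s ] (S v₀ ≐ wkᵗ s)
  predecessor {s = s} = ⇒-elim (at (basic pred) (s ∷ []))

  H⟪⟫ : Γ ⊩ H ⟪ s , t ⟫ ≐ s
  H⟪⟫ {s = s} {t = t} = at (basic H-pair) (s ∷ t ∷ [])

  T⟪⟫ : Γ ⊩ T ⟪ s , t ⟫ ≐ t
  T⟪⟫ {s = s} {t = t} = at (basic T-pair) (s ∷ t ∷ [])

  H0 : Γ ⊩ H 𝟎 ≐ 𝟎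
  H0 = at (basic H-zero) []

  T0 : Γ ⊩ T 𝟎 ≐ 𝟎
  T0 = at (basic T-zero) []

  -- The defining equation exhibits twice a pair as a successor.
  0<⟪⟫ : Γ ⊩ 𝟎 < ⟪ s , t ⟫
  0<⟪⟫ {s = s} {t = t} = ∨-elim (0-or-positive ⟪ s , t ⟫)
    (S≢0 (≐-trans (≐-sym +S) (≐-trans
      (≐-sym (forth (at (basic pair-def) (s ∷ t ∷ 𝟎 ∷ [])) h₀)) ·0)))
    h₀

  first : Γ ⊩ ⟪ s , t ⟫ ≐ u → Γ ⊩ s ≐ H u
  first p = ≐-trans (≐-sym H⟪⟫) (H-cong p)

  second : Γ ⊩ ⟪ s , t ⟫ ≐ u → Γ ⊩ t ≐ T u
  second p = ≐-trans (≐-sym T⟪⟫) (T-cong p)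

  -- Zero is not a pair, so decomposition needs a positive argument; at 0 both
  -- projections are 0.
  unpairing : _⊩_ {1} (𝟎 < v₀ ∷ []) (v₀ ≐ ⟪ H v₀ , T v₀ ⟫ ∧ H v₀ < v₀ ∧ T v₀ < v₀)
  unpairing = ∃-elim (⇒-elim (at (basic unpair) (v₀ ∷ [])) h₀)
    (∃-elim (∧-elim₂ h₀)
      (cut (∧-elim₂ h₀) (∧-intro
        (≐-trans (≐-sym h₀) (⟪⟫-cong (first h₀) (second h₀)))
        (∧-intro (<-cong (first h₀) ≐-refl (∧-elim₁ h₂))
                 (<-cong (second h₀) ≐-refl (∧-elim₁ h₁))))))

  pair-η : Γ ⊩ 𝟎 < s → Γ ⊩ s ≐ ⟪ H s , T s ⟫
  pair-η {s = s} p = ∧-elim₁ (apply unpairing (s ∷ []) (p ∷ []))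

  H< : Γ ⊩ 𝟎 < s → Γ ⊩ H s < s
  H< {s = s} p = ∧-elim₁ (∧-elim₂ (apply unpairing (s ∷ []) (p ∷ [])))

  T< : Γ ⊩ 𝟎 < s → Γ ⊩ T s < s
  T< {s = s} p = ∧-elim₂ (∧-elim₂ (apply unpairing (s ∷ []) (p ∷ [])))

  0-or-pair : ∀ s → Γ ⊩ s ≐ 𝟎 ∨ s ≐ ⟪ H s , T s ⟫
  0-or-pair s = ∨-elim (0-or-positive s) (∨-intro₁ h₀) (∨-intro₂ (pair-η h₀))

  H≤ : Γ ⊩ H s ≤ s
  H≤ {s = s} = ∨-elim (0-or-positive s)
    (∨-intro₂ (≐-trans (H-cong h₀) (≐-trans H0 (≐-sym h₀))))
    (∨-intro₁ (H< h₀))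

  T≤ : Γ ⊩ T s ≤ s
  T≤ {s = s} = ∨-elim (0-or-positive s)
    (∨-intro₂ (≐-trans (T-cong h₀) (≐-trans T0 (≐-sym h₀))))
    (∨-intro₁ (T< h₀))

-- Function symbols

axiom⁰ : Ax φ → Ax ⊢ φ
axiom⁰ {Ax = Ax} {φ = φ} a =
  along (subst-id (λ ()) φ) (axiom a)

module Function {Ax : Theory C} {f : C} (f∈𝓕 : Ax ⊢ f ∈𝓕) where

  total : ∀ s → Ax ∣ Γ ⊢ ∃̇ (f ⟨ wkᵗ s ⟩≐ v₀)
  total s = at (∧-elim₁ f∈𝓕) (s ∷ [])

  unique : Ax ∣ Γ ⊢ f ⟨ s ⟩≐ t → Ax ∣ Γ ⊢ f ⟨ s ⟩≐ u → Ax ∣ Γ ⊢ (t ≐ u)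
  unique {s = s} {t = t} {u = u} p q =
    ⇒-elim (at (∧-elim₁ (∧-elim₂ f∈𝓕)) (u ∷ t ∷ s ∷ [])) (∧-intro p q)

  0∉ : Ax ∣ Γ ⊢ (𝟎 ∉ f)
  0∉ = at {k = 0} (∧-elim₂ (∧-elim₂ f∈𝓕)) []

-- The polynomial that defines pairing: it bounds the pair, and unlike the
-- pair it is monotone by the shape of the term.
twice-pair : Term n → Term n → Term n
twice-pair s t = (s + t) · (s + t + 𝟏) + 𝟐 · s + 𝟐

-- The functions of ΔRA₁ decide bounded formulas

module Decision where

  open Basic {Ax = ΔRA₁} (λ b → axiom⁰ (basic b))

  private
    infix 0 _⊩_
    _⊩_ : List (Formula SetConst n) → Formula SetConst n → Set
    _⊩_ = ΔRA₁ ∣_⊢_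

    variable
      a b c d g h : Derivation

  ∈𝓕 : ∀ d → ΔRA₁ ⊢ 𝐟 d ∈𝓕
  ∈𝓕 X⋆        = axiom⁰ oracle-∈𝓕
  ∈𝓕 (op o ds) = axiom⁰ (operator-∈𝓕 o ds)

  module F (d : Derivation) = Function (∈𝓕 d)

  infixr 9 _∘ᵈ_

  Iᵈ <ᵈ Dᵈ zeroᵈ oneᵈ headᵈ tailᵈ : Derivation
  _∘ᵈ_ Pᵈ : Derivation → Derivation → Derivation

  Iᵈ      = op I []
  <ᵈ      = op <⋆ []
  Dᵈ      = op D []
  g ∘ᵈ h  = op ∘ (g ∷ h ∷ [])
  Pᵈ g h  = op P (g ∷ h ∷ [])
  zeroᵈ   = <ᵈ ∘ᵈ Pᵈ Iᵈ Iᵈ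
  oneᵈ    = op S [] ∘ᵈ zeroᵈ
  -- Definition by cases with a constant condition projects a pair, and maps
  -- 0 to 0 just as H and T do.
  headᵈ   = Dᵈ ∘ᵈ Pᵈ zeroᵈ Iᵈ
  tailᵈ   = Dᵈ ∘ᵈ Pᵈ oneᵈ Iᵈ

  condᵈ : Derivation → Derivation → Derivation → Derivation
  condᵈ c a b = Dᵈ ∘ᵈ Pᵈ c (Pᵈ b a)

  S-value : Γ ⊩ 𝐟 (op S []) ⟨ s ⟩≐ S s
  S-value {s = s} = at (axiom⁰ (operator S [])) (s ∷ [])

  +-value : Γ ⊩ 𝐟 (op ⊕ []) ⟨ ⟪ s , t ⟫ ⟩≐ (s + t)
  +-value {s = s} {t = t} = ∧-elim₁ (at (axiom⁰ (operator ⊕ [])) (s ∷ t ∷ []))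

  ·-value : Γ ⊩ 𝐟 (op ⊗ []) ⟨ ⟪ s , t ⟫ ⟩≐ (s · t)
  ·-value {s = s} {t = t} = ∧-elim₁ (at (axiom⁰ (operator ⊗ [])) (s ∷ t ∷ []))

  I-value : Γ ⊩ 𝐟 Iᵈ ⟨ s ⟩≐ s
  I-value {s = s} = at (axiom⁰ (operator I [])) (s ∷ [])

  <-value : Γ ⊩ s < t → Γ ⊩ 𝐟 <ᵈ ⟨ ⟪ s , t ⟫ ⟩≐ 𝟏
  <-value {s = s} {t = t} =
    ⇒-elim (∧-elim₁ (at (axiom⁰ (operator <⋆ [])) (s ∷ t ∷ [])))

  ≥-value : Γ ⊩ t ≤ s → Γ ⊩ 𝐟 <ᵈ ⟨ ⟪ s , t ⟫ ⟩≐ 𝟎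
  ≥-value {t = t} {s = s} =
    ⇒-elim (∧-elim₁ (∧-elim₂ (at (axiom⁰ (operator <⋆ [])) (s ∷ t ∷ []))))

  D-zero : Γ ⊩ 𝐟 Dᵈ ⟨ ⟪ 𝟎 , ⟪ s , t ⟫ ⟫ ⟩≐ s
  D-zero {s = s} {t = t} =
    ∧-elim₁ (at (axiom⁰ (operator D [])) (𝟎 ∷ s ∷ t ∷ []))

  D-suc : Γ ⊩ 𝐟 Dᵈ ⟨ ⟪ S u , ⟪ s , t ⟫ ⟫ ⟩≐ t
  D-suc {u = u} {s = s} {t = t} =
    ∧-elim₁ (∧-elim₂ (at (axiom⁰ (operator D [])) (u ∷ s ∷ t ∷ [])))

  D-empty : Γ ⊩ 𝐟 Dᵈ ⟨ ⟪ s , 𝟎 ⟫ ⟩≐ 𝟎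
  D-empty {s = s} =
    ∧-elim₂ (∧-elim₂ (∧-elim₂ (at (axiom⁰ (operator D [])) (s ∷ 𝟎 ∷ 𝟎 ∷ []))))

  P-value : Γ ⊩ 𝐟 g ⟨ s ⟩≐ t → Γ ⊩ 𝐟 h ⟨ s ⟩≐ u →
            Γ ⊩ 𝐟 (Pᵈ g h) ⟨ s ⟩≐ ⟪ t , u ⟫
  P-value {g = g} {s = s} {t = t} {h = h} {u = u} p q =
    ⇒-elim (at (axiom⁰ (operator P (g ∷ h ∷ []))) (s ∷ t ∷ u ∷ [])) (∧-intro p q)

  ∘-value : Γ ⊩ 𝐟 h ⟨ s ⟩≐ t → Γ ⊩ 𝐟 g ⟨ t ⟩≐ u → Γ ⊩ 𝐟 (g ∘ᵈ h) ⟨ s ⟩≐ u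
  ∘-value {h = h} {s = s} {t = t} {g = g} {u = u} p q =
    ⇒-elim (at (axiom⁰ (operator ∘ (g ∷ h ∷ []))) (s ∷ u ∷ t ∷ [])) (∧-intro p q)

  μᵈ : Derivation → Derivation
  μᵈ g = op μ (g ∷ [])

  μ≤ : Γ ⊩ 𝐟 (μᵈ g) ⟨ ⟪ t , s ⟫ ⟩≐ u → Γ ⊩ u ≤ t
  μ≤ {g = g} {t = t} {s = s} {u = u} = ⇒-elim
    (∧-elim₁ (at (axiom⁰ (operator μ (g ∷ []))) (s ∷ 𝟎 ∷ u ∷ t ∷ [])))

  μ-least : Γ ⊩ 𝐟 (μᵈ g) ⟨ ⟪ t , s ⟫ ⟩≐ u →
            Γ ⊩ s′ < t → Γ ⊩ 𝐟 g ⟨ ⟪ s′ , s ⟫ ⟩≐ 𝟏 → Γ ⊩ u ≤ s′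
  μ-least {g = g} {t = t} {s = s} {u = u} {s′ = s′} p q r = ⇒-elim
    (∧-elim₁ (∧-elim₂
      (at (axiom⁰ (operator μ (g ∷ []))) (s ∷ s′ ∷ u ∷ t ∷ []))))
    (∧-intro p (∧-intro q r))

  μ-holds : Γ ⊩ 𝐟 (μᵈ g) ⟨ ⟪ t , s ⟫ ⟩≐ u → Γ ⊩ u < t →
            Γ ⊩ 𝐟 g ⟨ ⟪ u , s ⟫ ⟩≐ 𝟏
  μ-holds {g = g} {t = t} {s = s} {u = u} p q = ⇒-elim
    (∧-elim₁ (∧-elim₂ (∧-elim₂
      (at (axiom⁰ (operator μ (g ∷ []))) (s ∷ 𝟎 ∷ u ∷ t ∷ [])))))
    (∧-intro p q)

  -- The axioms for < and S admit cycles of <.  They are excluded by the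
  -- characteristic function of <, which has only one value at each pair.
  asym : Γ ⊩ s < t → Γ ⊩ t ≤ s → Γ ⊩ χ
  asym p q = S≢0 (F.unique <ᵈ (<-value p) (≥-value q))

  zero-value : Γ ⊩ 𝐟 zeroᵈ ⟨ s ⟩≐ 𝟎
  zero-value = ∘-value (P-value I-value I-value) (≥-value (∨-intro₂ ≐-refl))

  one-value : Γ ⊩ 𝐟 oneᵈ ⟨ s ⟩≐ 𝟏
  one-value = ∘-value zero-value S-value

  head-value : Γ ⊩ 𝐟 headᵈ ⟨ s ⟩≐ H s
  head-value {s = s} = ∘-value (P-value zero-value I-value)
    (∨-elim (0-or-pair s)
      (value-cong (⟪⟫-cong ≐-refl (≐-sym h₀))
        (≐-sym (≐-trans (H-cong h₀) H0)) D-empty)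
      (value-cong (⟪⟫-cong ≐-refl (≐-sym h₀)) ≐-refl D-zero))

  tail-value : Γ ⊩ 𝐟 tailᵈ ⟨ s ⟩≐ T s
  tail-value {s = s} = ∘-value (P-value one-value I-value)
    (∨-elim (0-or-pair s)
      (value-cong (⟪⟫-cong ≐-refl (≐-sym h₀))
        (≐-sym (≐-trans (T-cong h₀) T0)) D-empty)
      (value-cong (⟪⟫-cong ≐-refl (≐-sym h₀)) ≐-refl D-suc))

  cond-value₁ : Γ ⊩ 𝐟 c ⟨ s ⟩≐ 𝟏 → Γ ⊩ 𝐟 a ⟨ s ⟩≐ t → Γ ⊩ 𝐟 b ⟨ s ⟩≐ u →
                Γ ⊩ 𝐟 (condᵈ c a b) ⟨ s ⟩≐ t
  cond-value₁ p q r = ∘-value (P-value p (P-value r q)) D-suc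

  cond-value₀ : Γ ⊩ 𝐟 c ⟨ s ⟩≐ 𝟎 → Γ ⊩ 𝐟 a ⟨ s ⟩≐ t → Γ ⊩ 𝐟 b ⟨ s ⟩≐ u →
                Γ ⊩ 𝐟 (condᵈ c a b) ⟨ s ⟩≐ u
  cond-value₀ p q r = ∘-value (P-value p (P-value r q)) D-zero

  -- The coded sequence of all free variables.  A new variable is put in front,
  -- which is the form in which μ supplies its search variable.
  environment : ∀ n → Term n
  environment zero    = 𝟎
  environment (suc n) = ⟪ v₀ , wkᵗ (environment n) ⟫

  varᵈ : Fin n → Derivation
  varᵈ zero    = headᵈ
  varᵈ (suc i) = varᵈ i ∘ᵈ tailᵈ

  var-value : (i : Fin n) → [] ⊩ 𝐟 (varᵈ i) ⟨ environment n ⟩≐ var i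
  var-value zero = value-cong ≐-refl H⟪⟫ head-value
  var-value {suc n} (suc i) = ∘-value tail-value
    (value-cong (≐-sym T⟪⟫) ≐-refl
      (≡-subst (λ e → [] ⊩ 𝐟 (varᵈ i) ⟨ e ⟩≐ var (suc i))
        (sym (renameᵗ≡substᵗ suc (environment n))) (⇑ (var-value i))))

  termᵈ : Term n → Derivation
  termᵈ (var i)   = varᵈ i
  termᵈ 𝟎         = zeroᵈ
  termᵈ (S t)     = op S [] ∘ᵈ termᵈ t
  termᵈ (H t)     = headᵈ ∘ᵈ termᵈ t
  termᵈ (T t)     = tailᵈ ∘ᵈ termᵈ t
  termᵈ (s + t)   = op ⊕ [] ∘ᵈ Pᵈ (termᵈ s) (termᵈ t)
  termᵈ (s · t)   = op ⊗ [] ∘ᵈ Pᵈ (termᵈ s) (termᵈ t)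
  termᵈ ⟪ s , t ⟫ = Pᵈ (termᵈ s) (termᵈ t)

  term-value : (t : Term n) → [] ⊩ 𝐟 (termᵈ t) ⟨ environment n ⟩≐ t
  term-value (var i)   = var-value i
  term-value 𝟎         = zero-value
  term-value (S t)     = ∘-value (term-value t) S-value
  term-value (H t)     = ∘-value (term-value t) head-value
  term-value (T t)     = ∘-value (term-value t) tail-value
  term-value (s + t)   = ∘-value (P-value (term-value s) (term-value t)) +-value
  term-value (s · t)   = ∘-value (P-value (term-value s) (term-value t)) ·-value
  term-value ⟪ s , t ⟫ = P-value (term-value s) (term-value t)

  -- Characteristic functions of formulas

  _decides_on_ : Derivation → Formula SetConst n → Term n → Formula SetConst n
  c decides φ on e = (φ ∧ 𝐟 c ⟨ e ⟩≐ 𝟏) ∨ (¬ φ ∧ 𝐟 c ⟨ e ⟩≐ 𝟎)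

  value⇔ : Γ ⊩ c decides φ on s → Γ ⊩ 𝐟 c ⟨ s ⟩≐ 𝟏 ⇔ φ
  value⇔ {c = c} p = ⇔-intro
    (∨-elim (↑ p) (∧-elim₁ h₀)
      (S≢0 (F.unique c h₁ (∧-elim₂ h₀))))
    (∨-elim (↑ p) (∧-elim₂ h₀) (contradiction h₁ (∧-elim₁ h₀)))

  decides-⇔ : Γ ⊩ φ ⇔ ψ → Γ ⊩ c decides φ on s → Γ ⊩ c decides ψ on s
  decides-⇔ e p = ∨-elim p
    (∨-intro₁ (∧-intro (forth (↑ e) (∧-elim₁ h₀)) (∧-elim₂ h₀)))
    (∨-intro₂ (∧-intro
      (⇒-intro (⇒-elim (∧-elim₁ h₁) (back (↑ ↑ e) h₀))) (∧-elim₂ h₀)))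

  decides-∘ : Γ ⊩ c decides φ on t → Γ ⊩ 𝐟 h ⟨ s ⟩≐ t → Γ ⊩ (c ∘ᵈ h) decides φ on s
  decides-∘ p q = ∨-elim p
    (∨-intro₁ (∧-intro (∧-elim₁ h₀) (∘-value (↑ q) (∧-elim₂ h₀))))
    (∨-intro₂ (∧-intro (∧-elim₁ h₀) (∘-value (↑ q) (∧-elim₂ h₀))))

  decides-false : Γ ⊩ zeroᵈ decides ⊥ on s
  decides-false = ∨-intro₂ (∧-intro (⇒-intro h₀) zero-value)

  decides-true : Γ ⊩ oneᵈ decides (¬ ⊥) on s
  decides-true = ∨-intro₁ (∧-intro (⇒-intro h₀) one-value)

  values : Γ ⊩ c decides φ on s →
           𝐟 c ⟨ s ⟩≐ 𝟏 ∷ Γ ⊩ ψ → 𝐟 c ⟨ s ⟩≐ 𝟎 ∷ Γ ⊩ ψ → Γ ⊩ ψ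
  values r p q = ∨-elim r
    (cut (∧-elim₂ h₀) (weaken (λ { (here e) → here e ; (there i) → there (there i) }) p))
    (cut (∧-elim₂ h₀) (weaken (λ { (here e) → here e ; (there i) → there (there i) }) q))

  decides-same : Γ ⊩ c decides φ on s →
                 𝐟 c ⟨ s ⟩≐ 𝟏 ∷ Γ ⊩ 𝐟 d ⟨ s ⟩≐ 𝟏 →
                 𝐟 c ⟨ s ⟩≐ 𝟎 ∷ Γ ⊩ 𝐟 d ⟨ s ⟩≐ 𝟎 → Γ ⊩ d decides φ on s
  decides-same r p q = ∨-elim r
    (∨-intro₁ (∧-intro (∧-elim₁ h₀) (⇒-elim (↑ ⇒-intro p) (∧-elim₂ h₀))))
    (∨-intro₂ (∧-intro (∧-elim₁ h₀) (⇒-elim (↑ ⇒-intro q) (∧-elim₂ h₀))))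

  -- All propositional connectives are instances of definition by cases.  The
  -- operator wants a value for both alternatives, hence the distinction of
  -- the values of the alternative that is not selected.
  decides-cond : Γ ⊩ c decides φ on s → Γ ⊩ a decides ψ on s → Γ ⊩ b decides χ on s →
                 Γ ⊩ condᵈ c a b decides ((φ ∧ ψ) ∨ (¬ φ ∧ χ)) on s
  decides-cond p q r = ∨-elim p
    (decides-⇔
      (⇔-intro (∨-intro₁ (∧-intro (∧-elim₁ h₁) h₀))
        (∨-elim h₀ (∧-elim₂ h₀) (contradiction (∧-elim₁ h₂) (∧-elim₁ h₀))))
      (decides-same (↑ q)
        (values (↑ ↑ r) (cond-value₁ (∧-elim₂ h₂) h₁ h₀) (cond-value₁ (∧-elim₂ h₂) h₁ h₀))
        (values (↑ ↑ r) (cond-value₁ (∧-elim₂ h₂) h₁ h₀) (cond-value₁ (∧-elim₂ h₂) h₁ h₀))))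
    (decides-⇔
      (⇔-intro (∨-intro₂ (∧-intro (∧-elim₁ h₁) h₀))
        (∨-elim h₀ (contradiction (∧-elim₁ h₀) (∧-elim₁ h₂)) (∧-elim₂ h₀)))
      (decides-same (↑ r)
        (values (↑ ↑ q) (cond-value₀ (∧-elim₂ h₂) h₀ h₁) (cond-value₀ (∧-elim₂ h₂) h₀ h₁))
        (values (↑ ↑ q) (cond-value₀ (∧-elim₂ h₂) h₀ h₁) (cond-value₀ (∧-elim₂ h₂) h₀ h₁))))

  <-decides : Γ ⊩ 𝐟 g ⟨ u ⟩≐ s → Γ ⊩ 𝐟 h ⟨ u ⟩≐ t →
              Γ ⊩ (<ᵈ ∘ᵈ Pᵈ g h) decides (s < t) on u
  <-decides {s = s} {t = t} p q = ∨-elim (<-or-≥ s t)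
    (∨-intro₁ (∧-intro h₀ (∘-value (P-value (↑ p) (↑ q)) (<-value h₀))))
    (∨-intro₂ (∧-intro (⇒-intro (asym h₀ h₁))
                       (∘-value (P-value (↑ p) (↑ q)) (≥-value h₀))))

  notᵈ : Derivation → Derivation
  notᵈ c = condᵈ c zeroᵈ oneᵈ

  not-decides : Γ ⊩ c decides φ on s → Γ ⊩ notᵈ c decides (¬ φ) on s
  not-decides p = decides-⇔
    (⇔-intro (∨-elim h₀ (efq (∧-elim₂ h₀)) (∧-elim₁ h₀))
             (∨-intro₂ (∧-intro h₀ (⇒-intro h₀))))
    (decides-cond p decides-false decides-true)

  eqᵈ : Derivation → Derivation → Derivation
  eqᵈ g h = condᵈ (<ᵈ ∘ᵈ Pᵈ g h) zeroᵈ (notᵈ (<ᵈ ∘ᵈ Pᵈ h g))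

  eq-decides : Γ ⊩ 𝐟 g ⟨ u ⟩≐ s → Γ ⊩ 𝐟 h ⟨ u ⟩≐ t →
               Γ ⊩ eqᵈ g h decides (s ≐ t) on u
  eq-decides {s = s} {t = t} p q = decides-⇔
    (⇔-intro
      (∨-elim h₀ (efq (∧-elim₂ h₀))
        (∨-elim (compare s t) (contradiction h₀ (∧-elim₁ h₁))
          (∨-elim h₀ h₀ (contradiction h₀ (∧-elim₂ h₂)))))
      (∨-intro₂ (∧-intro (⇒-intro (asym h₀ (∨-intro₂ (≐-sym h₁))))
                         (⇒-intro (asym h₀ (∨-intro₂ h₁))))))
    (decides-cond (<-decides p q) decides-false (not-decides (<-decides q p)))

  -- The test for 0 is needed because H and T decompose 0 like the pair of 0
  -- and 0, which may belong to the function.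
  memberᵈ : Derivation → Derivation
  memberᵈ d = condᵈ (<ᵈ ∘ᵈ Pᵈ zeroᵈ Iᵈ) (eqᵈ (d ∘ᵈ headᵈ) tailᵈ) zeroᵈ

  member-decides : ∀ d → _⊩_ {1} [] (memberᵈ d decides (v₀ ∈ 𝐟 d) on v₀)
  member-decides d = ∃-elim (F.total d (H v₀)) (decides-⇔
    (⇔-intro
      (∨-elim h₀
        (∈-cong (≐-sym (pair-η (∧-elim₁ h₀)))
          (value-cong ≐-refl (∧-elim₂ h₀) h₂))
        (efq (∧-elim₂ h₀)))
      (∨-elim (0-or-positive v₁)
        (contradiction (∈-cong h₀ h₁) (F.0∉ d))
        (∨-intro₁ (∧-intro h₀
          (F.unique d h₂ (∈-cong (pair-η h₀) h₁))))))
    (decides-cond (<-decides zero-value I-value)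
      (eq-decides (∘-value head-value h₀) tail-value)
      decides-false))

  -- The search for a witness below b returns b exactly if there is none.
  existsᵈ : Derivation → Derivation
  existsᵈ c = <ᵈ ∘ᵈ Pᵈ (μᵈ c) headᵈ

  exists-decides : ∀ c → _⊩_ {2} []
    (existsᵈ c decides ∃<[ v₀ ] (𝐟 c ⟨ ⟪ v₀ , v₂ ⟫ ⟩≐ 𝟏) on ⟪ v₀ , v₁ ⟫)
  exists-decides c = ∃-elim (F.total (μᵈ c) ⟪ v₀ , v₁ ⟫)
    (decides-⇔
      (⇔-intro (∃-intro v₀ (∧-intro h₀ (μ-holds h₁ h₀)))
        -- A witness y below b bounds the result r, so b ≤ r would give b ≤ y.
        (∃-elim h₀ (∨-elim (<-or-≥ v₁ v₂) h₀
          (∨-elim (μ-least h₃ (∧-elim₁ h₁) (∧-elim₂ h₁))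
            (asym (∧-elim₁ h₂) (∨-elim h₁
              (∨-intro₁ (asym h₀ (μ≤ (↑ h₄)))) (∨-intro₁ (<-cong (≐-sym h₀) ≐-refl h₁))))
            (asym (∧-elim₁ h₂) (≤-cong ≐-refl h₀ h₁))))))
      (<-decides h₀ (value-cong ≐-refl H⟪⟫ head-value)))

  oracle-decides : Γ ⊩ X⋆ decides (t ∈ 𝐗) on t
  oracle-decides {t = t} = by-cases (t ∈ 𝐗)
    (∨-intro₁ (∧-intro h₀ (⇒-elim (∧-elim₁ (at (axiom⁰ oracle) (t ∷ []))) h₀)))
    (∨-intro₂ (∧-intro h₀ (⇒-elim (∧-elim₂ (at (axiom⁰ oracle) (t ∷ []))) h₀)))

  formulaᵈ : {φ : Formula SetConst n} → Bounded φ → Derivation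
  formulaᵈ (s ≐ t)         = eqᵈ (termᵈ s) (termᵈ t)
  formulaᵈ (s < t)         = <ᵈ ∘ᵈ Pᵈ (termᵈ s) (termᵈ t)
  formulaᵈ (t ∈ 𝐗)         = X⋆ ∘ᵈ termᵈ t
  formulaᵈ (t ∈ 𝐟 d)       = memberᵈ d ∘ᵈ termᵈ t
  formulaᵈ ⊥               = zeroᵈ
  formulaᵈ (φ ⇒ ψ)         = condᵈ (formulaᵈ φ) (formulaᵈ ψ) oneᵈ
  formulaᵈ (φ ∧ ψ)         = condᵈ (formulaᵈ φ) (formulaᵈ ψ) zeroᵈ
  formulaᵈ (φ ∨ ψ)         = condᵈ (formulaᵈ φ) oneᵈ (formulaᵈ ψ)
  formulaᵈ (all t φ)       = notᵈ (existsᵈ (notᵈ (formulaᵈ φ)) ∘ᵈ Pᵈ (termᵈ t) Iᵈ)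
  formulaᵈ (ex t φ)        = existsᵈ (formulaᵈ φ) ∘ᵈ Pᵈ (termᵈ t) Iᵈ

  -- Since the sequence of variables of φ is that of the quantified formula with
  -- the bound variable in front, existsᵈ applies to a function deciding φ.
  bounded-exists-decides : (t : Term n) {φ : Formula SetConst (suc n)} →
    [] ⊩ c decides φ on environment (suc n) →
    [] ⊩ (existsᵈ c ∘ᵈ Pᵈ (termᵈ t) Iᵈ) decides ∃<[ t ] φ on environment n
  bounded-exists-decides {n = n} {c = c} t p = decides-⇔
    (∃-cong (∧-cong ⇔-refl (value⇔ p)))
    (decides-∘ (apply (exists-decides c) (t ∷ environment n ∷ []) [])
      (P-value (term-value t) I-value))

  formula-decides : {φ : Formula SetConst n} (b : Bounded φ) →
                    [] ⊩ formulaᵈ b decides φ on environment n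
  formula-decides (s ≐ t)   = eq-decides (term-value s) (term-value t)
  formula-decides (s < t)   = <-decides (term-value s) (term-value t)
  formula-decides (t ∈ 𝐗)   = decides-∘ oracle-decides (term-value t)
  formula-decides (t ∈ 𝐟 d) =
    decides-∘ (apply (member-decides d) (t ∷ []) []) (term-value t)
  formula-decides ⊥         = decides-false
  formula-decides (b ⇒ c)   = decides-⇔
    (⇔-intro
      (∨-elim h₀ (⇒-intro (∧-elim₂ h₁))
                 (⇒-intro (contradiction h₀ (∧-elim₁ h₁))))
      (by-cases _ (∨-intro₁ (∧-intro h₀ (⇒-elim h₁ h₀)))
                  (∨-intro₂ (∧-intro h₀ (⇒-intro h₀)))))
    (decides-cond (formula-decides b) (formula-decides c) decides-true)
  formula-decides (b ∧ c)   = decides-⇔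
    (⇔-intro (∨-elim h₀ h₀ (efq (∧-elim₂ h₀))) (∨-intro₁ h₀))
    (decides-cond (formula-decides b) (formula-decides c) decides-false)
  formula-decides (b ∨ c)   = decides-⇔
    (⇔-intro
      (∨-elim h₀ (∨-intro₁ (∧-elim₁ h₀)) (∨-intro₂ (∧-elim₂ h₀)))
      (by-cases _ (∨-intro₁ (∧-intro h₀ (⇒-intro h₀)))
        (∨-intro₂ (∧-intro h₀ (∨-elim h₁ (contradiction h₀ h₁) h₀)))))
    (decides-cond (formula-decides b) decides-true (formula-decides c))
  formula-decides (all t b) = decides-⇔
    (⇔-intro
      (∀-intro (⇒-intro (raa (⇒-elim h₂ (∃-variable (∧-intro h₁ h₀))))))
      (⇒-intro (∃-elim h₀ (⇒-elim (∧-elim₂ h₀)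
        (⇒-elim (↑ ↑ ∀-variable h₀) (∧-elim₁ h₀))))))
    (not-decides (bounded-exists-decides t (not-decides (formula-decides b))))
  formula-decides (ex t b)  = bounded-exists-decides t (formula-decides b)

  -- The search below b for y with c(y) = 1 returns the least such y or b
  -- itself.  In both cases c is 1 at the result, which is not 0 by the base
  -- case, and c is not 1 at its predecessor, which refutes the step.
  least-counterexample : ∀ c → _⊩_ {2}
    ( 𝐟 c ⟨ ⟪ v₀ , v₁ ⟫ ⟩≐ 𝟏
    ∷ (∀̇ (¬ (𝐟 c ⟨ ⟪ v₀ , v₂ ⟫ ⟩≐ 𝟏) ⇒ ¬ (𝐟 c ⟨ ⟪ v₀ + 𝟏 , v₂ ⟫ ⟩≐ 𝟏)))
    ∷ (¬ (𝐟 c ⟨ ⟪ 𝟎 , v₁ ⟫ ⟩≐ 𝟏))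
    ∷ [])
    ⊥
  least-counterexample c = ∃-elim (F.total (μᵈ c) ⟪ v₀ , v₁ ⟫)
    (cut (∨-elim (μ≤ h₀) (μ-holds h₁ h₀)
            (value-cong (⟪⟫-cong (≐-sym h₀) ≐-refl) ≐-refl h₂))
      (∨-elim (0-or-positive v₀)
        (⇒-elim (↑ h₄) (value-cong (⟪⟫-cong h₀ ≐-refl) ≐-refl h₁))
        -- Variable 0 is now y with y + 1 the least counterexample.
        (∃-elim (predecessor h₀)
          (cut (y<b (∧-elim₂ h₀) (μ≤ h₃))
            (⇒-elim
              (⇒-elim (∀-elim (↑ ↑ h₄) v₀)
                (⇒-intro (asym (∧-elim₁ h₂) (μ-least (↑ h₄) h₁ h₀))))
              (value-cong (⟪⟫-cong (≐-trans (≐-sym (∧-elim₂ h₁)) (≐-sym +1)) ≐-refl)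
                ≐-refl h₃))))))
    where
    -- A strict bound on the predecessor, from asymmetry and linearity alone.
    y<b : Γ ⊩ S s ≐ t → Γ ⊩ t ≤ u → Γ ⊩ s < u
    y<b {s = s} {u = u} p q = ∨-elim (<-or-≥ s u) h₀
      (asym (≤⇒<S h₀) (≤-cong (≐-sym (↑ p)) ≐-refl (↑ q)))

  no-counterexamples : ∀ c → _⊩_ {1} []
    (progressive⇒all (¬ (𝐟 c ⟨ ⟪ v₀ , v₁ ⟫ ⟩≐ 𝟏)))
  no-counterexamples c = ⇒-intro (∀-intro (⇒-intro
    (apply (least-counterexample c) (v₀ ∷ v₁ ∷ [])
      (h₀ ∷ ∧-elim₂ h₁ ∷ ∧-elim₁ h₁ ∷ []))))

  -- Counterexamples to φ are found by the function deciding its negation.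
  ΔRA₁-induction : {φ : Formula SetConst (suc n)} → Bounded φ → [] ⊩ progressive⇒all φ
  ΔRA₁-induction {n = n} {φ = φ} b = progressive⇒all-cong φ⇔ (on-environment
    (apply (no-counterexamples refuteᵈ) (environment n ∷ []) []))
    where
    refuteᵈ = notᵈ (formulaᵈ b)
    no-counterexample : ∀ {m} → Term (suc m) → Formula SetConst (suc m)
    no-counterexample e = ¬ (𝐟 refuteᵈ ⟨ ⟪ v₀ , e ⟫ ⟩≐ 𝟏)
    φ⇔ : [] ⊩ φ ⇔ no-counterexample (wkᵗ (environment n))
    φ⇔ = ⇔-intro
      (⇒-intro (⇒-elim (forth refute⇔ h₀) h₁))
      (raa (⇒-elim h₁ (back refute⇔ h₀)))
      where
      refute⇔ : ∀ {Γ} → Γ ⊩ 𝐟 refuteᵈ ⟨ environment (suc n) ⟩≐ 𝟏 ⇔ ¬ φ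
      refute⇔ = value⇔ (close (not-decides (formula-decides b)))
    on-environment :
      [] ⊩ ¬ (𝐟 refuteᵈ ⟨ ⟪ 𝟎 , environment n ⟫ ⟩≐ 𝟏)
            ∧ (∀̇ (no-counterexample (wkᵗ (environment n)) ⇒
                  ¬ (𝐟 refuteᵈ ⟨ ⟪ v₀ + 𝟏 , wkᵗ (environment n) ⟫ ⟩≐ 𝟏)))
            ⇒ ∀̇ no-counterexample (wkᵗ (environment n)) →
      [] ⊩ progressive⇒all (no-counterexample (wkᵗ (environment n)))
    on-environment p
      rewrite substᵗ-instantiate-wkᵗ 𝟎 (environment n)
            | substᵗ-update-wkᵗ (v₀ + 𝟏) (environment n) = p

-- Arithmetic from induction for bounded formulas

module Arithmetic {Ax : Theory C}
  (basic : ∀ {φ} → BASIC φ → Ax ⊢ φ)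
  (induct : ∀ {n} {φ : Formula C (suc n)} → Bounded φ → Ax ∣ [] ⊢ progressive⇒all φ)
  where

  open Basic basic public

  private
    infix 0 _⊩_
    _⊩_ : List (Formula C n) → Formula C n → Set
    _⊩_ = Ax ∣_⊢_

  -- The formula φ◌ has a marked place for the successor, so that v₀ + 1 can be
  -- exchanged for S v₀ there.
  by-induction : {φ : Formula C (suc n)} → Bounded φ → Γ ⊩ φ [ 𝟎 ] →
                 φ ∷ map wk Γ ⊩ replace₀ (S v₀) φ → map wk Γ ⊩ φ
  by-induction {Γ = Γ} {φ = φ} b p q = ∀-variable (⇒-elim (close (induct b))
    (∧-intro p (∀-intro (⇒-intro
      (along (marked (v₀ + 𝟏))
        (≐-subst φ◌ (≐-sym +1) (along (sym (marked (S v₀))) q)))))))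
    where
    φ◌ = subst (λ { zero → v₀ ; (suc i) → var (suc (suc i)) }) φ
    marked : ∀ t → φ◌ [ t ] ≡ replace₀ t φ
    marked t = trans (subst-subst _ _ φ)
      (subst-cong (λ { zero → refl ; (suc i) → refl }) φ)

  <ᵇ : Bounded {C} (s < t)
  <ᵇ = _ < _

  ≤ᵇ : Bounded {C} (s ≤ t)
  ≤ᵇ = (_ < _) ∨ (_ ≐ _)

  private
    <-trans′ : _⊩_ {3} (v₁ < v₂ ∷ []) (v₂ < v₀ ⇒ v₁ < v₀)
    <-trans′ = by-induction {Γ = v₀ < v₁ ∷ []} (<ᵇ ⇒ <ᵇ)
      (⇒-intro (≮𝟎 h₀))
      (⇒-intro (∨-elim (<S⇒≤ h₀)
        (≤⇒<S (∨-intro₁ (⇒-elim h₂ h₀)))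
        (≤⇒<S (∨-intro₁ (<-cong ≐-refl h₀ h₃)))))

  <-trans : Γ ⊩ s < t → Γ ⊩ t < u → Γ ⊩ s < u
  <-trans {s = s} {t = t} {u = u} p q =
    ⇒-elim (apply <-trans′ (u ∷ s ∷ t ∷ []) (p ∷ [])) q

  private
    <-irrefl′ : _⊩_ {1} [] (¬ (v₀ < v₀))
    <-irrefl′ = by-induction (<ᵇ ⇒ ⊥)
      (⇒-intro (≮𝟎 h₀))
      (⇒-intro (∨-elim (<S⇒≤ h₀)
        (⇒-elim h₂ (<-trans n<S h₀))
        (⇒-elim h₂ (<-cong ≐-refl h₀ n<S))))

  <-irrefl : Γ ⊩ s < s → Γ ⊩ χ
  <-irrefl {s = s} p = contradiction p (apply <-irrefl′ (s ∷ []) [])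

  <-≤-trans : Γ ⊩ s < t → Γ ⊩ t ≤ u → Γ ⊩ s < u
  <-≤-trans p q = ∨-elim q (<-trans (↑ p) h₀) (<-cong ≐-refl h₀ (↑ p))

  ≤-trans : Γ ⊩ s ≤ t → Γ ⊩ t ≤ u → Γ ⊩ s ≤ u
  ≤-trans p q = ∨-elim p (∨-intro₁ (<-≤-trans h₀ (↑ q))) (≤-cong (≐-sym h₀) ≐-refl (↑ q))

  ≐⇒≤ : Γ ⊩ s ≐ t → Γ ⊩ s ≤ t
  ≐⇒≤ = ∨-intro₂

  ≤-refl : Γ ⊩ s ≤ s
  ≤-refl = ≐⇒≤ ≐-refl

  <-≤-absurd : Γ ⊩ s < t → Γ ⊩ t ≤ s → Γ ⊩ χ
  <-≤-absurd p q = <-irrefl (<-≤-trans p q)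

  <⇒S≤ : Γ ⊩ s < t → Γ ⊩ S s ≤ t
  <⇒S≤ {s = s} {t = t} p = ∨-elim (<-or-≥ t (S s)) (<-≤-absurd (↑ p) (<S⇒≤ h₀)) h₀

  S-mono : Γ ⊩ s ≤ t → Γ ⊩ S s ≤ S t
  S-mono p = <⇒S≤ (≤⇒<S p)

  ≤S : Γ ⊩ s ≤ S s
  ≤S = ∨-intro₁ n<S

  private
    +-monoˡ′ : _⊩_ {3} (v₁ ≤ v₂ ∷ []) (v₁ + v₀ ≤ v₂ + v₀)
    +-monoˡ′ = by-induction {Γ = v₀ ≤ v₁ ∷ []} ≤ᵇ
      (≤-cong (≐-sym +0) (≐-sym +0) h₀)
      (≤-cong (≐-sym +S) (≐-sym +S) (S-mono h₀))

    +-monoʳ′ : _⊩_ {3} [] (v₁ ≤ v₀ ⇒ v₂ + v₁ ≤ v₂ + v₀)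
    +-monoʳ′ = by-induction (≤ᵇ ⇒ ≤ᵇ)
      (⇒-intro (∨-elim h₀ (≮𝟎 h₀) (≐⇒≤ (+-cong ≐-refl h₀))))
      (⇒-intro (∨-elim h₀
        (≤-trans (⇒-elim h₂ (<S⇒≤ h₀)) (≤-cong ≐-refl (≐-sym +S) ≤S))
        (≐⇒≤ (+-cong ≐-refl h₀))))

  +-mono : Γ ⊩ s ≤ s′ → Γ ⊩ t ≤ t′ → Γ ⊩ s + t ≤ s′ + t′
  +-mono {s = s} {s′ = s′} {t = t} {t′ = t′} p q = ≤-trans
    (apply +-monoˡ′ (t ∷ s ∷ s′ ∷ []) (p ∷ []))
    (⇒-elim (apply +-monoʳ′ (t′ ∷ t ∷ s′ ∷ []) []) q)

  s≤s+t : Γ ⊩ s ≤ s + t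
  s≤s+t = ≤-trans (≐⇒≤ (≐-sym +0)) (+-mono ≤-refl 0≤)

  private
    ·-monoˡ′ : _⊩_ {3} (v₁ ≤ v₂ ∷ []) (v₁ · v₀ ≤ v₂ · v₀)
    ·-monoˡ′ = by-induction {Γ = v₀ ≤ v₁ ∷ []} ≤ᵇ
      (≐⇒≤ (≐-trans ·0 (≐-sym ·0)))
      (≤-cong (≐-sym ·S) (≐-sym ·S) (+-mono h₀ h₁))

    ·-monoʳ′ : _⊩_ {3} [] (v₁ ≤ v₀ ⇒ v₂ · v₁ ≤ v₂ · v₀)
    ·-monoʳ′ = by-induction (≤ᵇ ⇒ ≤ᵇ)
      (⇒-intro (∨-elim h₀ (≮𝟎 h₀) (≐⇒≤ (·-cong ≐-refl h₀))))
      (⇒-intro (∨-elim h₀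
        (≤-trans (⇒-elim h₂ (<S⇒≤ h₀)) (≤-cong ≐-refl (≐-sym ·S) s≤s+t))
        (≐⇒≤ (·-cong ≐-refl h₀))))

    s≤2s′ : _⊩_ {1} [] (v₀ ≤ 𝟐 · v₀)
    s≤2s′ = by-induction ≤ᵇ 0≤
      (≤-cong ≐-refl (≐-sym (≐-trans ·S +S)) (S-mono (≤-trans h₀ s≤s+t)))

  ·-mono : Γ ⊩ s ≤ s′ → Γ ⊩ t ≤ t′ → Γ ⊩ s · t ≤ s′ · t′
  ·-mono {s = s} {s′ = s′} {t = t} {t′ = t′} p q = ≤-trans
    (apply ·-monoˡ′ (t ∷ s ∷ s′ ∷ []) (p ∷ []))
    (⇒-elim (apply ·-monoʳ′ (t′ ∷ t ∷ s′ ∷ []) []) q)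

  s≤2s : Γ ⊩ s ≤ 𝟐 · s
  s≤2s {s = s} = apply s≤2s′ (s ∷ []) []

  ⟪⟫≤ : Γ ⊩ ⟪ s , t ⟫ ≤ twice-pair s t
  ⟪⟫≤ {s = s} {t = t} = ≤-cong ≐-refl
    (forth (at (basic pair-def) (s ∷ t ∷ ⟪ s , t ⟫ ∷ [])) ≐-refl) s≤2s

  twice-pair-mono : Γ ⊩ s ≤ s′ → Γ ⊩ t ≤ t′ → Γ ⊩ twice-pair s t ≤ twice-pair s′ t′
  twice-pair-mono p q =
    +-mono (+-mono (·-mono (+-mono p q) (+-mono (+-mono p q) ≤-refl))
                   (·-mono ≤-refl p)) ≤-refl

-- Replacing set constants by formulas

-- This eliminates defined functions; with atoms v₀ ∈ κ f it is renaming by κ.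
unfold : (C → Formula C′ 1) → Formula C n → Formula C′ n
unfold α (s ≐ t) = s ≐ t
unfold α (s < t) = s < t
unfold α (t ∈ f) = α f ⟦ t ∷ [] ⟧
unfold α ⊥       = ⊥
unfold α (φ ⇒ ψ) = unfold α φ ⇒ unfold α ψ
unfold α (φ ∧ ψ) = unfold α φ ∧ unfold α ψ
unfold α (φ ∨ ψ) = unfold α φ ∨ unfold α ψ
unfold α (∀̇ φ)   = ∀̇ unfold α φ
unfold α (∃̇ φ)   = ∃̇ unfold α φ

unfold-cong : {Ax : Theory C′} {α β : C → Formula C′ 1} →
              (∀ f → Ax ∣ [] ⊢ (α f ⇔ β f)) →
              (φ : Formula C n) → Ax ∣ [] ⊢ (unfold α φ ⇔ unfold β φ)
unfold-cong e (s ≐ t) = ⇔-refl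
unfold-cong e (s < t) = ⇔-refl
unfold-cong e (t ∈ f) = apply (e f) (t ∷ []) []
unfold-cong e ⊥       = ⇔-refl
unfold-cong e (φ ⇒ ψ) = ⇒-cong (unfold-cong e φ) (unfold-cong e ψ)
unfold-cong e (φ ∧ ψ) = ∧-cong (unfold-cong e φ) (unfold-cong e ψ)
unfold-cong e (φ ∨ ψ) = ∨-cong (unfold-cong e φ) (unfold-cong e ψ)
unfold-cong e (∀̇ φ)   = ∀-cong (unfold-cong e φ)
unfold-cong e (∃̇ φ)   = ∃-cong (unfold-cong e φ)

unfold-constants : (κ : C → C′) (φ : Formula C n) →
                   unfold (λ f → v₀ ∈ κ f) φ ≡ mapConst κ φ
unfold-constants κ (s ≐ t) = refl
unfold-constants κ (s < t) = refl
unfold-constants κ (t ∈ f) = refl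
unfold-constants κ ⊥       = refl
unfold-constants κ (φ ⇒ ψ) = cong₂ _⇒_ (unfold-constants κ φ) (unfold-constants κ ψ)
unfold-constants κ (φ ∧ ψ) = cong₂ _∧_ (unfold-constants κ φ) (unfold-constants κ ψ)
unfold-constants κ (φ ∨ ψ) = cong₂ _∨_ (unfold-constants κ φ) (unfold-constants κ ψ)
unfold-constants κ (∀̇ φ)   = cong ∀̇_ (unfold-constants κ φ)
unfold-constants κ (∃̇ φ)   = cong ∃̇_ (unfold-constants κ φ)

mapConst-subst : (κ : C → C′) {σ : Fin m → Term n} (φ : Formula C m) →
                 mapConst κ (subst σ φ) ≡ subst σ (mapConst κ φ)
mapConst-subst κ (s ≐ t) = refl
mapConst-subst κ (s < t) = refl
mapConst-subst κ (t ∈ f) = refl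
mapConst-subst κ ⊥       = refl
mapConst-subst κ (φ ⇒ ψ) = cong₂ _⇒_ (mapConst-subst κ φ) (mapConst-subst κ ψ)
mapConst-subst κ (φ ∧ ψ) = cong₂ _∧_ (mapConst-subst κ φ) (mapConst-subst κ ψ)
mapConst-subst κ (φ ∨ ψ) = cong₂ _∨_ (mapConst-subst κ φ) (mapConst-subst κ ψ)
mapConst-subst κ (∀̇ φ)   = cong ∀̇_ (mapConst-subst κ φ)
mapConst-subst κ (∃̇ φ)   = cong ∃̇_ (mapConst-subst κ φ)

mapConst-unfold : (κ : C′ → C″) (α : C → Formula C′ 1) (φ : Formula C n) →
                  mapConst κ (unfold α φ) ≡ unfold (λ f → mapConst κ (α f)) φ
mapConst-unfold κ α (s ≐ t) = refl
mapConst-unfold κ α (s < t) = refl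
mapConst-unfold κ α (t ∈ f) = mapConst-subst κ (α f)
mapConst-unfold κ α ⊥       = refl
mapConst-unfold κ α (φ ⇒ ψ) = cong₂ _⇒_ (mapConst-unfold κ α φ) (mapConst-unfold κ α ψ)
mapConst-unfold κ α (φ ∧ ψ) = cong₂ _∧_ (mapConst-unfold κ α φ) (mapConst-unfold κ α ψ)
mapConst-unfold κ α (φ ∨ ψ) = cong₂ _∨_ (mapConst-unfold κ α φ) (mapConst-unfold κ α ψ)
mapConst-unfold κ α (∀̇ φ)   = cong ∀̇_ (mapConst-unfold κ α φ)
mapConst-unfold κ α (∃̇ φ)   = cong ∃̇_ (mapConst-unfold κ α φ)

mapConst-id : (φ : Formula C n) → mapConst (λ f → f) φ ≡ φ
mapConst-id (s ≐ t) = refl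
mapConst-id (s < t) = refl
mapConst-id (t ∈ f) = refl
mapConst-id ⊥       = refl
mapConst-id (φ ⇒ ψ) = cong₂ _⇒_ (mapConst-id φ) (mapConst-id ψ)
mapConst-id (φ ∧ ψ) = cong₂ _∧_ (mapConst-id φ) (mapConst-id ψ)
mapConst-id (φ ∨ ψ) = cong₂ _∨_ (mapConst-id φ) (mapConst-id ψ)
mapConst-id (∀̇ φ)   = cong ∀̇_ (mapConst-id φ)
mapConst-id (∃̇ φ)   = cong ∃̇_ (mapConst-id φ)

mapConst-closure : (κ : C → C′) → ∀ n {φ : Formula C n} →
                   mapConst κ (closure n φ) ≡ closure n (mapConst κ φ)
mapConst-closure κ zero    = refl
mapConst-closure κ (suc n) = mapConst-closure κ n

mapConst-induction : (κ : C → C′) (φ : Formula C (suc n)) →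
                     mapConst κ (induction φ) ≡ induction (mapConst κ φ)
mapConst-induction {n = n} κ φ = trans (mapConst-closure κ n)
  (cong (closure n)
    (cong₂ (λ base step → base ∧ (∀̇ (mapConst κ φ ⇒ step)) ⇒ ∀̇ mapConst κ φ)
      (mapConst-subst κ φ) (mapConst-subst κ φ)))

bounded-unfold : {α : C → Formula C′ 1} → (∀ f → Bounded (α f)) →
                 {φ : Formula C n} → Bounded φ → Bounded (unfold α φ)
bounded-unfold β (s ≐ t)   = s ≐ t
bounded-unfold β (s < t)   = s < t
bounded-unfold β (t ∈ f)   = bounded-subst (β f)
bounded-unfold β ⊥         = ⊥
bounded-unfold β (b ⇒ c)   = bounded-unfold β b ⇒ bounded-unfold β c
bounded-unfold β (b ∧ c)   = bounded-unfold β b ∧ bounded-unfold β c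
bounded-unfold β (b ∨ c)   = bounded-unfold β b ∨ bounded-unfold β c
bounded-unfold β (all t b) = all t (bounded-unfold β b)
bounded-unfold β (ex t b)  = ex t (bounded-unfold β b)

mapConst-bounded : (κ : C → C′) {φ : Formula C n} → Bounded φ → Bounded (mapConst κ φ)
mapConst-bounded κ {φ} b =
  ≡-subst Bounded (unfold-constants κ φ) (bounded-unfold (λ f → v₀ ∈ κ f) b)

mapConst-BASIC : (κ : C → C′) {φ : Sentence C} → BASIC φ → BASIC (mapConst κ φ)
mapConst-BASIC κ S≠0      = S≠0
mapConst-BASIC κ S-inj    = S-inj
mapConst-BASIC κ +-zero   = +-zero
mapConst-BASIC κ +-suc    = +-suc
mapConst-BASIC κ ·-zero   = ·-zero
mapConst-BASIC κ ·-suc    = ·-suc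
mapConst-BASIC κ ≮0       = ≮0
mapConst-BASIC κ <-suc    = <-suc
mapConst-BASIC κ <-cmp    = <-cmp
mapConst-BASIC κ pred     = pred
mapConst-BASIC κ pair-def = pair-def
mapConst-BASIC κ pair-inj = pair-inj
mapConst-BASIC κ unpair   = unpair
mapConst-BASIC κ H-pair   = H-pair
mapConst-BASIC κ H-zero   = H-zero
mapConst-BASIC κ T-pair   = T-pair
mapConst-BASIC κ T-zero   = T-zero

-- Bounds and graphs of the functions

module _ (Q : Derivation → Set) where

  Below : Derivation → Set
  Below X⋆        = ⊤
  Below (op o ds) = ∀ i → Q (lookup ds i)

  module _ (step : ∀ d → Below d → Q d) where

    derivation-induction : ∀ d → Q d
    derivation-inductions : (ds : Vec Derivation k) → ∀ i → Q (lookup ds i)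

    derivation-induction X⋆        = step X⋆ tt
    derivation-induction (op o ds) = step (op o ds) (derivation-inductions ds)

    derivation-inductions (d ∷ ds) zero    = derivation-induction d
    derivation-inductions (d ∷ ds) (suc i) = derivation-inductions ds i

below-all : {Q : Derivation → Set} → (∀ d → Q d) → ∀ d → Below Q d
below-all q X⋆        = tt
below-all q (op o ds) = λ i → q (lookup ds i)

below-map : {Q R : Derivation → Set} → (∀ {d} → Q d → R d) →
            ∀ d → Below Q d → Below R d
below-map q X⋆        _     = tt
below-map q (op o ds) below = λ i → q (below i)

-- Each clause is monotone in s, so that the bounds of a composition compose.
-- A bound is a function on terms in any number of variables, natural under
-- substitution, rather than a term in one variable.
bound : Derivation → Term n → Term n
bound X⋆                    s = 𝟏
bound (op S [])             s = S s
bound (op ⊕ [])             s = s + s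
bound (op ⊗ [])             s = s · s
bound (op <⋆ [])            s = 𝟏
bound (op I [])             s = s
bound (op D [])             s = s
bound (op P (g ∷ h ∷ []))   s = twice-pair (bound g s) (bound h s)
bound (op ∘ (g ∷ h ∷ []))   s = bound g (bound h s)
bound (op μ (g ∷ []))       s = s

bound-substᵗ : (σ : Fin m → Term n) → ∀ d s →
               substᵗ σ (bound d s) ≡ bound d (substᵗ σ s)
bound-substᵗ σ X⋆                  s = refl
bound-substᵗ σ (op S [])           s = refl
bound-substᵗ σ (op ⊕ [])           s = refl
bound-substᵗ σ (op ⊗ [])           s = refl
bound-substᵗ σ (op <⋆ [])          s = refl
bound-substᵗ σ (op I [])           s = refl
bound-substᵗ σ (op D [])           s = refl
bound-substᵗ σ (op P (g ∷ h ∷ [])) s =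
  cong₂ twice-pair (bound-substᵗ σ g s) (bound-substᵗ σ h s)
bound-substᵗ σ (op ∘ (g ∷ h ∷ [])) s =
  trans (bound-substᵗ σ g (bound h s)) (cong (bound g) (bound-substᵗ σ h s))
bound-substᵗ σ (op μ (g ∷ []))     s = refl

bound-wkᵗ : ∀ d (s : Term n) → wkᵗ (bound d s) ≡ bound d (wkᵗ s)
bound-wkᵗ d s = trans (renameᵗ≡substᵗ suc _) (trans (bound-substᵗ _ d s)
                  (cong (bound d) (sym (renameᵗ≡substᵗ suc s))))

-- In the graphs, index 0 is the value and index 1 the argument.

branch : Formula C 2 → Term 2 → Term 2 → Formula C 2
branch χ s t = (χ ∧ v₀ ≐ s) ∨ (¬ χ ∧ v₀ ≐ t)

oracle-graph : C → Formula C 2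
oracle-graph X = branch (v₁ ∈ X) 𝟏 𝟎

pattern arg₀ = inj₂ zero
pattern arg₁ = inj₂ (suc zero)

-- The graphs are bounded formulas, to which induction applies; the
-- derivations enter only through the bound in a composition.  At argument 0
-- the clauses with H and T give the value 0, as H 0 = T 0 = 0.
operator-graph : Operator k → Vec Derivation k → Formula (⊤ ⊎ Fin k) 2
operator-graph S  _ = v₀ ≐ S v₁
operator-graph ⊕  _ = v₀ ≐ H v₁ + T v₁
operator-graph ⊗  _ = v₀ ≐ H v₁ · T v₁
operator-graph <⋆ _ = branch (H v₁ < T v₁) 𝟏 𝟎
operator-graph I  _ = v₀ ≐ v₁
operator-graph D  _ = branch (H v₁ ≐ 𝟎) (H (T v₁)) (T (T v₁))
operator-graph P  _ = 𝟎 < v₀ ∧ arg₀ ⟨ v₁ ⟩≐ H v₀ ∧ arg₁ ⟨ v₁ ⟩≐ T v₀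
operator-graph ∘ (g ∷ h ∷ []) =
  ∃<[ S (bound h v₁) ] (arg₁ ⟨ v₂ ⟩≐ v₀ ∧ arg₀ ⟨ v₀ ⟩≐ v₁)
operator-graph μ _ =
    v₀ ≤ H v₁
  ∧ (∀<[ H v₁ ] (arg₀ ⟨ ⟪ v₀ , T v₂ ⟫ ⟩≐ 𝟏 ⇒ v₁ ≤ v₀))
  ∧ (v₀ < H v₁ ⇒ arg₀ ⟨ ⟪ v₀ , T v₁ ⟫ ⟩≐ 𝟏)

operator-graph-bounded : (o : Operator k) (ds : Vec Derivation k) →
                         Bounded (operator-graph o ds)
operator-graph-bounded S  _ = _ ≐ _
operator-graph-bounded ⊕  _ = _ ≐ _
operator-graph-bounded ⊗  _ = _ ≐ _
operator-graph-bounded <⋆ _ = ((_ < _) ∧ (_ ≐ _)) ∨ (((_ < _) ⇒ ⊥) ∧ (_ ≐ _))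
operator-graph-bounded I  _ = _ ≐ _
operator-graph-bounded D  _ = ((_ ≐ _) ∧ (_ ≐ _)) ∨ (((_ ≐ _) ⇒ ⊥) ∧ (_ ≐ _))
operator-graph-bounded P  _ = (_ < _) ∧ (_ ∈ _) ∧ (_ ∈ _)
operator-graph-bounded ∘ (g ∷ h ∷ []) = ex _ ((_ ∈ _) ∧ (_ ∈ _))
operator-graph-bounded μ  _ =
  ((_ < _) ∨ (_ ≐ _)) ∧ all _ ((_ ∈ _) ⇒ ((_ < _) ∨ (_ ≐ _))) ∧ ((_ < _) ⇒ (_ ∈ _))

graph : Derivation → Formula SetConst 2
graph X⋆        = oracle-graph 𝐗
graph (op o ds) = mapConst (Sum.map₂ (lookup ds)) (operator-graph o ds)

-- The set of all pairs of argument and value related by θ.  It must be cut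
-- down to positive numbers, because H and T map 0 like the pair of 0 and 0.
pairs : Formula C 2 → Formula C 1
pairs θ = 𝟎 < v₀ ∧ θ ⟦ T v₀ ∷ H v₀ ∷ [] ⟧

-- Functions of subderivations are replaced by their definitions, so that X
-- remains as the only set constant.
definition  : Derivation → Formula ⊤ 1
definitions : Vec Derivation k → ⊤ ⊎ Fin k → Formula ⊤ 1

definition X⋆        = pairs (oracle-graph tt)
definition (op o ds) = pairs (unfold (definitions ds) (operator-graph o ds))

definitions ds       (inj₁ tt)      = v₀ ∈ tt
definitions (d ∷ ds) (inj₂ zero)    = definition d
definitions (d ∷ ds) (inj₂ (suc i)) = definitions ds (inj₂ i)

definition-bounded  : ∀ d → Bounded (definition d)
definitions-bounded : (ds : Vec Derivation k) → ∀ f → Bounded (definitions ds f)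

definition-bounded X⋆ =
  (_ < _) ∧ (((_ ∈ _) ∧ (_ ≐ _)) ∨ (((_ ∈ _) ⇒ ⊥) ∧ (_ ≐ _)))
definition-bounded (op o ds) = (_ < _) ∧
  bounded-subst (bounded-unfold (definitions-bounded ds) (operator-graph-bounded o ds))

definitions-bounded ds       (inj₁ tt)      = v₀ ∈ tt
definitions-bounded (d ∷ ds) (inj₂ zero)    = definition-bounded d
definitions-bounded (d ∷ ds) (inj₂ (suc i)) = definitions-bounded ds (inj₂ i)

rewriting₂ : (θ : Formula C 2) → Ax ∣ Γ ⊢ (s ≐ s′) → Ax ∣ Γ ⊢ (t ≐ t′) →
             Ax ∣ Γ ⊢ θ ⟦ s ∷ t ∷ [] ⟧ → Ax ∣ Γ ⊢ θ ⟦ s′ ∷ t′ ∷ [] ⟧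
rewriting₂ {Ax = Ax} θ p q r = along swap
  (rewriting (θ ⟦ v₁ ∷ v₀ ∷ [] ⟧) (_ ∷ []) q
    (along (sym swap) (rewriting θ (_ ∷ []) p r)))
  where
  swap : ∀ {n} {s t : Term n} → θ ⟦ v₁ ∷ v₀ ∷ [] ⟧ ⟦ t ∷ s ∷ [] ⟧ ≡ θ ⟦ s ∷ t ∷ [] ⟧
  swap = trans (subst-subst _ _ θ)
    (subst-cong (λ { zero → refl ; (suc zero) → refl }) θ)

-- Theories in which the functions are given by their graphs

module Graphs {Ax : Theory SetConst}
  (basic : ∀ {φ} → BASIC φ → Ax ⊢ φ)
  (induct : ∀ {n} {φ : Formula SetConst (suc n)} → Bounded φ →
            Ax ∣ [] ⊢ progressive⇒all φ)
  where

  open Arithmetic basic induct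

  private
    infix 0 _⊩_
    _⊩_ : List (Formula SetConst n) → Formula SetConst n → Set
    _⊩_ = Ax ∣_⊢_

    variable
      d g h : Derivation

  HasDefinition HasGraph : Derivation → Set
  HasDefinition d = _⊩_ {1} [] (v₀ ∈ 𝐟 d ⇔ mapConst inj₁ (definition d))
  HasGraph d      = [] ⊩ 𝐟 d ⟨ v₁ ⟩≐ v₀ ⇔ graph d

  pairs-of-pair : (θ : Formula SetConst 2) → [] ⊩ pairs θ ⟦ ⟪ v₁ , v₀ ⟫ ∷ [] ⟧ ⇔ θ
  pairs-of-pair θ = ⇔-intro
    (along (subst-id (λ { zero → refl ; (suc zero) → refl }) θ)
      (rewriting₂ θ T⟪⟫ H⟪⟫ (along at-pair (∧-elim₂ h₀))))
    (∧-intro 0<⟪⟫ (along (sym at-pair)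
      (rewriting₂ θ (≐-sym T⟪⟫) (≐-sym H⟪⟫)
        (along (sym (subst-id (λ { zero → refl ; (suc zero) → refl }) θ)) h₀))))
    where
    at-pair : θ ⟦ T v₀ ∷ H v₀ ∷ [] ⟧ ⟦ ⟪ v₁ , v₀ ⟫ ∷ [] ⟧ ≡
              θ ⟦ T ⟪ v₁ , v₀ ⟫ ∷ H ⟪ v₁ , v₀ ⟫ ∷ [] ⟧
    at-pair = trans (subst-subst _ _ θ)
      (subst-cong (λ { zero → refl ; (suc zero) → refl }) θ)

  -- One level of unwinding: if the subderivations are defined correctly, the
  -- explicit definition may be read as the graph in terms of their functions.
  definition⇔pairs : ∀ d → Below HasDefinition d →
                     _⊩_ {1} [] (mapConst inj₁ (definition d) ⇔ pairs (graph d))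
  definition⇔pairs X⋆        _     = ⇔-refl
  definition⇔pairs (op o ds) below = ∧-cong ⇔-refl
    (≡-subst (λ θ → [] ⊩ θ ⇔ graph (op o ds) ⟦ T v₀ ∷ H v₀ ∷ [] ⟧)
      (sym (mapConst-subst inj₁ (unfold (definitions ds) (operator-graph o ds))))
      (apply unfolded (T v₀ ∷ H v₀ ∷ []) []))
    where
    arguments : ∀ {k} (ds : Vec Derivation k) → (∀ i → HasDefinition (lookup ds i)) →
      ∀ f → [] ⊩ mapConst inj₁ (definitions ds f) ⇔ v₀ ∈ Sum.map₂ (lookup ds) f
    arguments ds       below (inj₁ tt)      = ⇔-refl
    arguments (d ∷ ds) below (inj₂ zero)    = ⇔-sym (below zero)
    arguments (d ∷ ds) below (inj₂ (suc i)) =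
      arguments ds (λ j → below (suc j)) (inj₂ i)
    unfolded : [] ⊩ mapConst inj₁ (unfold (definitions ds) (operator-graph o ds))
                    ⇔ graph (op o ds)
    unfolded = ≡-subst (λ θ → [] ⊩ θ ⇔ graph (op o ds))
      (sym (mapConst-unfold inj₁ (definitions ds) (operator-graph o ds)))
      (≡-subst (λ θ → [] ⊩ unfold (λ f → mapConst inj₁ (definitions ds f))
                             (operator-graph o ds) ⇔ θ)
        (unfold-constants (Sum.map₂ (lookup ds)) (operator-graph o ds))
        (unfold-cong (arguments ds below) (operator-graph o ds)))

  definition⇒graph : ∀ d → Below HasDefinition d → HasDefinition d → HasGraph d
  definition⇒graph d below e = ⇔-trans
    (apply (⇔-trans e (definition⇔pairs d below)) (⟪ v₁ , v₀ ⟫ ∷ []) [])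
    (pairs-of-pair (graph d))

  definition⇒0∉ : ∀ d → Below HasDefinition d → HasDefinition d → _⊩_ {0} [] (𝟎 ∉ 𝐟 d)
  definition⇒0∉ d below e = ⇒-intro (≮𝟎 (∧-elim₁
    (forth (apply (⇔-trans e (definition⇔pairs d below)) (𝟎 ∷ []) []) h₀)))

  graph⇒definition : ∀ d → Below HasDefinition d → _⊩_ {0} [] (𝟎 ∉ 𝐟 d) → HasGraph d →
                     HasDefinition d
  graph⇒definition d below 0∉d e = ⇔-trans
    (⇔-intro
      (∨-elim (0-or-positive v₀)
        (contradiction (∈-cong h₀ h₁) (apply 0∉d [] []))
        (∧-intro h₀ (forth (apply e (T v₀ ∷ H v₀ ∷ []) [])
          (∈-cong (pair-η h₀) h₁))))
      (∈-cong (≐-sym (pair-η (∧-elim₁ h₀)))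
        (back (apply e (T v₀ ∷ H v₀ ∷ []) []) (∧-elim₂ h₀))))
    (⇔-sym (definition⇔pairs d below))

  -- Polynomial bounds

  HasBound : Derivation → Set
  HasBound d = _⊩_ {2} (𝐟 d ⟨ v₁ ⟩≐ v₀ ∷ []) (v₀ ≤ bound d v₁)

  value≤bound : HasBound d → Γ ⊩ 𝐟 d ⟨ s ⟩≐ t → Γ ⊩ t ≤ bound d s
  value≤bound {d = d} {Γ = Γ} {s = s} {t = t} p q =
    ≡-subst (λ u → Γ ⊩ t ≤ u) (bound-substᵗ _ d v₁) (apply p (t ∷ s ∷ []) (q ∷ []))

  bound-mono : ∀ d → Γ ⊩ s ≤ t → Γ ⊩ bound d s ≤ bound d t
  bound-mono X⋆                  p = ≤-refl
  bound-mono (op S [])           p = S-mono p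
  bound-mono (op ⊕ [])           p = +-mono p p
  bound-mono (op ⊗ [])           p = ·-mono p p
  bound-mono (op <⋆ [])          p = ≤-refl
  bound-mono (op I [])           p = p
  bound-mono (op D [])           p = p
  bound-mono (op P (g ∷ h ∷ [])) p = twice-pair-mono (bound-mono g p) (bound-mono h p)
  bound-mono (op ∘ (g ∷ h ∷ [])) p = bound-mono g (bound-mono h p)
  bound-mono (op μ (g ∷ []))     p = p

  -- Under bounds for the arguments, the search in the graph of a
  -- composition can be read as unbounded.
  ∘-graph : HasBound h → [] ⊩
    graph (op ∘ (g ∷ h ∷ [])) ⇔ ∃̇ (𝐟 h ⟨ v₂ ⟩≐ v₀ ∧ 𝐟 g ⟨ v₀ ⟩≐ v₁)
  ∘-graph {h = h} b rewrite bound-wkᵗ h (var {2} (suc zero)) = ∃-cong (⇔-intro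
    (∧-elim₂ h₀)
    (∧-intro (≤⇒<S (value≤bound b (∧-elim₁ h₀))) h₀))

  branch≤ : Γ ⊩ s ≤ u → Γ ⊩ t ≤ u →
            Γ ⊩ (χ ∧ s′ ≐ s) ∨ (¬ χ ∧ s′ ≐ t) → Γ ⊩ s′ ≤ u
  branch≤ p q r = ∨-elim r
    (≤-trans (≐⇒≤ (∧-elim₂ h₀)) (↑ p)) (≤-trans (≐⇒≤ (∧-elim₂ h₀)) (↑ q))

  graph-bound : ∀ d → Below HasBound d → graph d ∷ [] ⊩ v₀ ≤ bound d v₁
  graph-bound X⋆         _ = branch≤ ≤-refl 0≤ h₀
  graph-bound (op S [])  _ = ≐⇒≤ h₀
  graph-bound (op ⊕ [])  _ = ≤-trans (≐⇒≤ h₀) (+-mono H≤ T≤)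
  graph-bound (op ⊗ [])  _ = ≤-trans (≐⇒≤ h₀) (·-mono H≤ T≤)
  graph-bound (op <⋆ []) _ = branch≤ ≤-refl 0≤ h₀
  graph-bound (op I [])  _ = ≐⇒≤ h₀
  graph-bound (op D [])  _ = branch≤ (≤-trans H≤ T≤) (≤-trans T≤ T≤) h₀
  graph-bound (op P (g ∷ h ∷ [])) below =
    ≤-trans (≐⇒≤ (pair-η (∧-elim₁ h₀)))
      (≤-trans ⟪⟫≤ (twice-pair-mono
        (value≤bound (below zero) (∧-elim₁ (∧-elim₂ h₀)))
        (value≤bound (below (suc zero)) (∧-elim₂ (∧-elim₂ h₀)))))
  graph-bound (op ∘ (g ∷ h ∷ [])) below =
    ∃-elim (forth (close (∘-graph {g = g} (below (suc zero)))) h₀)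
      (along (cong (v₁ ≤_)
        (sym (trans (bound-substᵗ _ g _) (cong (bound g) (bound-substᵗ _ h _)))))
        (≤-trans (value≤bound (below zero) (∧-elim₂ h₀))
          (bound-mono g (value≤bound (below (suc zero)) (∧-elim₁ h₀)))))
  graph-bound (op μ (g ∷ [])) _ = ≤-trans (∧-elim₁ h₀) H≤

  has-bound : Below HasBound d → HasGraph d → HasBound d
  has-bound {d = d} below e =
    cut (forth (↑ e) h₀) (weaken (λ { (here p) → here p }) (graph-bound d below))

  -- The graphs are graphs of functions

  IsFunction Tame : Derivation → Set
  IsFunction d = Ax ⊢ 𝐟 d ∈𝓕
  Tame d       = IsFunction d × HasBound d

  private
    module F {d : Derivation} (tame : Tame d) = Function (proj₁ tame)

  -- Variables: the result, the search bound, the parameter.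
  search-result : SetConst → Formula SetConst 3
  search-result f = (∀<[ v₁ ] (f ⟨ ⟪ v₀ , v₃ ⟫ ⟩≐ 𝟏 ⇒ v₁ ≤ v₀))
                  ∧ (v₀ < v₁ ⇒ f ⟨ ⟪ v₀ , v₂ ⟫ ⟩≐ 𝟏)

  -- Induction on the search bound: increasing it changes the result only
  -- if the search has failed so far, and then to one of two values.
  least : (f : SetConst) → [] ⊩ ∃<[ S v₀ ] search-result f
  least f = by-induction {φ = ∃<[ S v₀ ] search-result f}
    (ex (S v₀) (all v₁ ((_ ∈ _) ⇒ ≤ᵇ) ∧ (<ᵇ ⇒ (_ ∈ _))))
    (∃-intro 𝟎 (∧-intro n<S (∧-intro
      (∀-intro (⇒-intro (≮𝟎 h₀)))
      (⇒-intro (≮𝟎 h₀)))))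
    (∃-elim h₀ (∨-elim (<S⇒≤ (∧-elim₁ h₀))
      (∃-intro v₀ (∧-intro (<-trans h₀ (<-trans n<S n<S)) (∧-intro
        (∀-intro (⇒-intro (⇒-intro (∨-elim (<S⇒≤ h₁)
          (⇒-elim (⇒-elim (∀-elim (∧-elim₁ (∧-elim₂ h₄)) v₀) h₀) h₁)
          (∨-intro₁ (<-cong ≐-refl (≐-sym h₀) h₃))))))
        (⇒-intro (⇒-elim (∧-elim₂ (∧-elim₂ h₂)) h₁)))))
      (by-cases (f ⟨ ⟪ v₁ , v₂ ⟫ ⟩≐ 𝟏)
        (∃-intro v₁ (∧-intro (<-trans n<S n<S) (∧-intro
          (∀-intro (⇒-intro (⇒-intro (∨-elim (<S⇒≤ h₁)
            (≤-cong h₄ ≐-refl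
              (⇒-elim (⇒-elim (∀-elim (∧-elim₁ (∧-elim₂ (↑ h₄))) v₀) h₀) h₁))
            (≐⇒≤ (≐-sym h₀))))))
          (⇒-intro h₁))))
        (∃-intro (S v₁) (∧-intro n<S (∧-intro
          (∀-intro (⇒-intro (⇒-intro (∨-elim (<S⇒≤ h₁)
            (<-≤-absurd h₀ (≤-cong h₄ ≐-refl
              (⇒-elim (⇒-elim (∀-elim (∧-elim₁ (∧-elim₂ (↑ h₄))) v₀) h₀) h₁)))
            (contradiction (value-cong (⟪⟫-cong h₀ ≐-refl) ≐-refl h₁) h₃)))))
          (⇒-intro (<-irrefl h₀))))))))

  graph-total : ∀ d → Below Tame d → [] ⊩ ∃̇ graph d
  graph-total X⋆ _ = by-cases (v₀ ∈ 𝐗)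
    (∃-intro 𝟏 (∨-intro₁ (∧-intro h₀ ≐-refl)))
    (∃-intro 𝟎 (∨-intro₂ (∧-intro h₀ ≐-refl)))
  graph-total (op S [])  _ = ∃-intro (S v₀) ≐-refl
  graph-total (op ⊕ [])  _ = ∃-intro (H v₀ + T v₀) ≐-refl
  graph-total (op ⊗ [])  _ = ∃-intro (H v₀ · T v₀) ≐-refl
  graph-total (op <⋆ []) _ = by-cases (H v₀ < T v₀)
    (∃-intro 𝟏 (∨-intro₁ (∧-intro h₀ ≐-refl)))
    (∃-intro 𝟎 (∨-intro₂ (∧-intro h₀ ≐-refl)))
  graph-total (op I [])  _ = ∃-intro v₀ ≐-refl
  graph-total (op D [])  _ = by-cases (H v₀ ≐ 𝟎)
    (∃-intro (H (T v₀)) (∨-intro₁ (∧-intro h₀ ≐-refl)))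
    (∃-intro (T (T v₀)) (∨-intro₂ (∧-intro h₀ ≐-refl)))
  graph-total (op P (g ∷ h ∷ [])) tame =
    ∃-elim (F.total (tame zero) v₀)
      (∃-elim (F.total (tame (suc zero)) v₁)
        (∃-intro ⟪ v₁ , v₀ ⟫ (∧-intro 0<⟪⟫ (∧-intro
          (value-cong ≐-refl (≐-sym H⟪⟫) h₁)
          (value-cong ≐-refl (≐-sym T⟪⟫) h₀)))))
  graph-total (op ∘ (g ∷ h ∷ [])) tame =
    back (∃-cong (∘-graph {g = g} (proj₂ (tame (suc zero)))))
      (∃-elim (F.total (tame (suc zero)) v₀)
        (∃-elim (F.total (tame zero) v₀)
          (∃-intro v₀ (∃-intro v₁ (∧-intro h₁ h₀)))))
  graph-total (op μ (g ∷ [])) _ =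
    ∃-mono (∧-intro (<S⇒≤ (∧-elim₁ h₀)) (∧-elim₂ h₀))
      (apply (least (𝐟 g)) (H v₀ ∷ T v₀ ∷ []) [])

  branch-unique : Γ ⊩ (χ ∧ s ≐ t) ∨ (¬ χ ∧ s ≐ t′) →
                  Γ ⊩ (χ ∧ u ≐ t) ∨ (¬ χ ∧ u ≐ t′) → Γ ⊩ s ≐ u
  branch-unique p q = ∨-elim p
    (∨-elim (↑ q) (≐-trans (∧-elim₂ h₁) (≐-sym (∧-elim₂ h₀)))
                  (contradiction (∧-elim₁ h₁) (∧-elim₁ h₀)))
    (∨-elim (↑ q) (contradiction (∧-elim₁ h₀) (∧-elim₁ h₁))
                  (≐-trans (∧-elim₂ h₁) (≐-sym (∧-elim₂ h₀))))

  -- A result below another one is below the search bound, hence satisfies the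
  -- condition searched for and bounds the other from above.
  μ-graph-minimal : ∀ g → let θ = graph (op μ (g ∷ [])) in
    _⊩_ {3} (v₀ < v₁ ∷ θ ⟦ v₀ ∷ v₂ ∷ [] ⟧ ∷ θ ⟦ v₁ ∷ v₂ ∷ [] ⟧ ∷ []) (v₀ ≐ v₁)
  μ-graph-minimal g = cut (<-≤-trans h₀ (∧-elim₁ h₂))
    (<-≤-absurd h₁ (⇒-elim (⇒-elim (∀-elim (∧-elim₁ (∧-elim₂ h₃)) v₀) h₀)
                           (⇒-elim (∧-elim₂ (∧-elim₂ h₂)) h₀)))

  graph-unique : ∀ d → Below Tame d →
    _⊩_ {3} (graph d ⟦ v₀ ∷ v₂ ∷ [] ⟧ ∷ graph d ⟦ v₁ ∷ v₂ ∷ [] ⟧ ∷ []) (v₀ ≐ v₁)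
  graph-unique X⋆         _ = branch-unique h₀ h₁
  graph-unique (op S [])  _ = ≐-trans h₀ (≐-sym h₁)
  graph-unique (op ⊕ [])  _ = ≐-trans h₀ (≐-sym h₁)
  graph-unique (op ⊗ [])  _ = ≐-trans h₀ (≐-sym h₁)
  graph-unique (op <⋆ []) _ = branch-unique h₀ h₁
  graph-unique (op I [])  _ = ≐-trans h₀ (≐-sym h₁)
  graph-unique (op D [])  _ = branch-unique h₀ h₁
  graph-unique (op P (g ∷ h ∷ [])) tame =
    ≐-trans (pair-η (∧-elim₁ h₀)) (≐-trans
      (⟪⟫-cong
        (F.unique (tame zero) (∧-elim₁ (∧-elim₂ h₀)) (∧-elim₁ (∧-elim₂ h₁)))
        (F.unique (tame (suc zero)) (∧-elim₂ (∧-elim₂ h₀)) (∧-elim₂ (∧-elim₂ h₁))))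
      (≐-sym (pair-η (∧-elim₁ h₁))))
  graph-unique (op ∘ (g ∷ h ∷ [])) tame =
    cut (forth (apply ∘-graph′ (v₀ ∷ v₂ ∷ []) []) h₀)
      (cut (forth (apply ∘-graph′ (v₁ ∷ v₂ ∷ []) []) h₂)
        (∃-elim h₁ (∃-elim h₁
          (F.unique (tame zero) (∧-elim₂ h₁)
            (value-cong (F.unique (tame (suc zero)) (∧-elim₁ h₀) (∧-elim₁ h₁)) ≐-refl
              (∧-elim₂ h₀))))))
    where
    ∘-graph′ = ∘-graph {g = g} (proj₂ (tame (suc zero)))
  graph-unique (op μ (g ∷ [])) _ = ∨-elim (compare v₀ v₁)
    (apply (μ-graph-minimal g) (v₀ ∷ v₁ ∷ v₂ ∷ []) (h₀ ∷ h₁ ∷ h₂ ∷ []))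
    (∨-elim h₀ h₀
      (≐-sym (apply (μ-graph-minimal g) (v₁ ∷ v₀ ∷ v₂ ∷ []) (h₀ ∷ h₃ ∷ h₂ ∷ []))))

  graph-unique-at : Below Tame d → Γ ⊩ graph d ⟦ s ∷ u ∷ [] ⟧ →
                    Γ ⊩ graph d ⟦ t ∷ u ∷ [] ⟧ → Γ ⊩ s ≐ t
  graph-unique-at {d = d} {s = s} {u = u} {t = t} tame p q =
    apply (graph-unique d tame) (s ∷ t ∷ u ∷ []) (along instance₁ p ∷ along instance₂ q ∷ [])
    where
    instance₁ : graph d ⟦ s ∷ u ∷ [] ⟧ ≡ graph d ⟦ v₀ ∷ v₂ ∷ [] ⟧ ⟦ s ∷ t ∷ u ∷ [] ⟧
    instance₁ = sym (trans (subst-subst _ _ (graph d))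
      (subst-cong (λ { zero → refl ; (suc zero) → refl }) (graph d)))
    instance₂ : graph d ⟦ t ∷ u ∷ [] ⟧ ≡ graph d ⟦ v₁ ∷ v₂ ∷ [] ⟧ ⟦ s ∷ t ∷ u ∷ [] ⟧
    instance₂ = sym (trans (subst-subst _ _ (graph d))
      (subst-cong (λ { zero → refl ; (suc zero) → refl }) (graph d)))

  graph-wk : (θ : Formula SetConst 2) → θ ⟦ v₁ ∷ v₂ ∷ [] ⟧ ≡ wk θ
  graph-wk = subst-cong λ { zero → refl ; (suc zero) → refl }

  -- A functional relation that contains a total one is equal to it.  With the
  -- operator axiom of μ it is easier to show that the function is contained in
  -- the graph, with the other axioms the converse inclusion.
  value⇒graph : Below Tame d → IsFunction d →
                𝐟 d ⟨ v₁ ⟩≐ v₀ ∷ [] ⊩ graph d → HasGraph d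
  value⇒graph {d = d} tame f∈𝓕 p = ⇔-intro p
    (∃-elim (Function.total f∈𝓕 v₁)
      (value-cong ≐-refl
        (graph-unique-at tame (apply p (v₀ ∷ v₂ ∷ []) (h₀ ∷ []))
          (along (sym (graph-wk (graph d))) h₁))
        h₀))

  graph⇒value : Below Tame d → IsFunction d →
                graph d ∷ [] ⊩ 𝐟 d ⟨ v₁ ⟩≐ v₀ → HasGraph d
  graph⇒value {d = d} tame f∈𝓕 p = ⇔-intro
    (∃-elim (apply (graph-total d tame) (v₁ ∷ []) [])
      (along (graph-wk (graph d))
        (rewriting (graph d) (v₂ ∷ [])
          (Function.unique f∈𝓕
            (apply p (v₀ ∷ v₂ ∷ []) (along total-graph h₀ ∷ [])) h₁)
          (along total-graph h₀))))
    p
    where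
    total-graph : subst (liftˢ (lookup (v₁ ∷ []))) (graph d) ≡ graph d ⟦ v₀ ∷ v₂ ∷ [] ⟧
    total-graph = subst-cong (λ { zero → refl ; (suc zero) → refl }) (graph d)

  graph⇒function : ∀ d → Below Tame d → _⊩_ {0} [] (𝟎 ∉ 𝐟 d) → HasGraph d → IsFunction d
  graph⇒function d tame 0∉d e = ∧-intro
    (∀-intro (∃-mono (back (close e) h₀) (graph-total d tame)))
    (∧-intro
      (∀-intro (∀-intro (∀-intro (⇒-intro
        (graph-unique-at tame
          (forth (apply e (v₁ ∷ v₂ ∷ []) []) (∧-elim₁ h₀))
          (forth (apply e (v₀ ∷ v₂ ∷ []) []) (∧-elim₂ h₀)))))))
      0∉d)

  -- The graphs amount to the axioms of the operators

  law : Derivation → Sentence SetConst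
  law X⋆        = 𝐟 X⋆ ≔-oracle 𝐗
  law (op o ds) = 𝐟 (op o ds) ≔ o ⟨ Vec.map inj₂ ds ⟩

  graph⇒law : ∀ d → Below Tame d → HasGraph d → [] ⊩ law d
  graph⇒law X⋆ _ e = closure-intro 1 (∧-intro
    (⇒-intro (back (apply e (𝟏 ∷ v₀ ∷ []) []) (∨-intro₁ (∧-intro h₀ ≐-refl))))
    (⇒-intro (back (apply e (𝟎 ∷ v₀ ∷ []) []) (∨-intro₂ (∧-intro h₀ ≐-refl)))))
  graph⇒law (op S []) _ e = closure-intro 1
    (back (apply e (S v₀ ∷ v₀ ∷ []) []) ≐-refl)
  graph⇒law (op ⊕ []) _ e = closure-intro 2 (∧-intro
    (back (apply e (v₀ + v₁ ∷ ⟪ v₀ , v₁ ⟫ ∷ []) []) (≐-sym (+-cong H⟪⟫ T⟪⟫)))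
    (back (apply e (𝟎 ∷ 𝟎 ∷ []) []) (≐-sym (≐-trans (+-cong H0 T0) +0))))
  graph⇒law (op ⊗ []) _ e = closure-intro 2 (∧-intro
    (back (apply e (v₀ · v₁ ∷ ⟪ v₀ , v₁ ⟫ ∷ []) []) (≐-sym (·-cong H⟪⟫ T⟪⟫)))
    (back (apply e (𝟎 ∷ 𝟎 ∷ []) []) (≐-sym (≐-trans (·-cong H0 T0) ·0))))
  graph⇒law (op <⋆ []) _ e = closure-intro 2 (∧-intro
    (⇒-intro (back (apply e (𝟏 ∷ ⟪ v₀ , v₁ ⟫ ∷ []) [])
      (∨-intro₁ (∧-intro (<-cong (≐-sym H⟪⟫) (≐-sym T⟪⟫) h₀) ≐-refl))))
    (∧-intro
      (⇒-intro (back (apply e (𝟎 ∷ ⟪ v₀ , v₁ ⟫ ∷ []) [])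
        (∨-intro₂ (∧-intro
          (⇒-intro (<-≤-absurd (<-cong H⟪⟫ T⟪⟫ h₀) h₁)) ≐-refl))))
      (back (apply e (𝟎 ∷ 𝟎 ∷ []) [])
        (∨-intro₂ (∧-intro (⇒-intro (≮𝟎 (<-cong ≐-refl T0 h₀))) ≐-refl)))))
  graph⇒law (op I []) _ e = closure-intro 1
    (back (apply e (v₀ ∷ v₀ ∷ []) []) ≐-refl)
  graph⇒law (op D []) _ e = closure-intro 3 (∧-intro
    (back (apply e (v₁ ∷ ⟪ 𝟎 , ⟪ v₁ , v₂ ⟫ ⟫ ∷ []) [])
      (∨-intro₁ (∧-intro H⟪⟫ (≐-sym (≐-trans (H-cong T⟪⟫) H⟪⟫)))))
    (∧-intro
      (back (apply e (v₂ ∷ ⟪ S v₀ , ⟪ v₁ , v₂ ⟫ ⟫ ∷ []) [])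
        (∨-intro₂ (∧-intro (⇒-intro (S≢0 (≐-trans (≐-sym H⟪⟫) h₀)))
                           (≐-sym (≐-trans (T-cong T⟪⟫) T⟪⟫)))))
      (∧-intro
        (back (apply e (𝟎 ∷ 𝟎 ∷ []) [])
          (∨-intro₁ (∧-intro H0 (≐-sym (≐-trans (H-cong T0) H0)))))
        (back (apply e (𝟎 ∷ ⟪ v₀ , 𝟎 ⟫ ∷ []) [])
          (by-cases (H ⟪ v₀ , 𝟎 ⟫ ≐ 𝟎)
            (∨-intro₁ (∧-intro h₀ (≐-sym (≐-trans (H-cong T⟪⟫) H0))))
            (∨-intro₂ (∧-intro h₀ (≐-sym (≐-trans (T-cong T⟪⟫) T0)))))))))
  graph⇒law (op P (g ∷ h ∷ [])) _ e = closure-intro 3 (⇒-intro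
    (back (apply e (⟪ v₁ , v₂ ⟫ ∷ v₀ ∷ []) []) (∧-intro 0<⟪⟫ (∧-intro
      (value-cong ≐-refl (≐-sym H⟪⟫) (∧-elim₁ h₀))
      (value-cong ≐-refl (≐-sym T⟪⟫) (∧-elim₂ h₀))))))
  graph⇒law (op ∘ (g ∷ h ∷ [])) tame e = closure-intro 3 (⇒-intro
    (back (apply (⇔-trans e (∘-graph {g = g} (proj₂ (tame (suc zero))))) (v₁ ∷ v₀ ∷ []) [])
      (∃-intro v₂ h₀)))
  graph⇒law (op μ (g ∷ [])) _ e = closure-intro 4 (∧-intro
    (⇒-intro (≤-cong ≐-refl H⟪⟫ (∧-elim₁ (result h₀))))
    (∧-intro
      (⇒-intro (⇒-elim
        (⇒-elim (∀-elim (∧-elim₁ (∧-elim₂ (result (∧-elim₁ h₀)))) v₁)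
          (<-cong ≐-refl (≐-sym H⟪⟫) (∧-elim₁ (∧-elim₂ h₀))))
        (value-cong (⟪⟫-cong ≐-refl (≐-sym T⟪⟫)) ≐-refl (∧-elim₂ (∧-elim₂ h₀)))))
      (∧-intro
        (⇒-intro (value-cong (⟪⟫-cong ≐-refl T⟪⟫) ≐-refl
          (⇒-elim (∧-elim₂ (∧-elim₂ (result (∧-elim₁ h₀))))
            (<-cong ≐-refl (≐-sym H⟪⟫) (∧-elim₂ h₀)))))
        (back (apply e (𝟎 ∷ 𝟎 ∷ []) []) (∧-intro 0≤ (∧-intro
          (∀-intro (⇒-intro (⇒-intro 0≤)))
          (⇒-intro (≮𝟎 (<-cong ≐-refl H0 h₀)))))))))
    where
    result : ∀ {Γ} → Γ ⊩ 𝐟 (op μ (g ∷ [])) ⟨ ⟪ v₃ , v₀ ⟫ ⟩≐ v₂ →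
             Γ ⊩ graph (op μ (g ∷ [])) ⟦ v₂ ∷ ⟪ v₃ , v₀ ⟫ ∷ [] ⟧
    result = forth (apply e (v₂ ∷ ⟪ v₃ , v₀ ⟫ ∷ []) [])

  branch⇒value : Γ ⊩ χ ⇒ 𝐟 d ⟨ u ⟩≐ s → Γ ⊩ ¬ χ ⇒ 𝐟 d ⟨ u ⟩≐ t →
                 Γ ⊩ (χ ∧ s′ ≐ s) ∨ (¬ χ ∧ s′ ≐ t) → Γ ⊩ 𝐟 d ⟨ u ⟩≐ s′
  branch⇒value p q r = ∨-elim r
    (value-cong ≐-refl (≐-sym (∧-elim₂ h₀)) (⇒-elim (↑ p) (∧-elim₁ h₀)))
    (value-cong ≐-refl (≐-sym (∧-elim₂ h₀)) (⇒-elim (↑ q) (∧-elim₁ h₀)))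

  value-by-pairs : ∀ s →
    Γ ⊩ s ≐ 𝟎 ⇒ 𝐟 d ⟨ 𝟎 ⟩≐ t →
    Γ ⊩ s ≐ ⟪ H s , T s ⟫ ⇒ 𝐟 d ⟨ ⟪ H s , T s ⟫ ⟩≐ t →
    Γ ⊩ 𝐟 d ⟨ s ⟩≐ t
  value-by-pairs s p q = ∨-elim (0-or-pair s)
    (value-cong (≐-sym h₀) ≐-refl (⇒-elim (↑ p) h₀))
    (value-cong (≐-sym h₀) ≐-refl (⇒-elim (↑ q) h₀))

  -- The axioms fix the functions on 0 and on pairs, which exhaust the numbers;
  -- the graphs describe the same values through H and T.
  law⇒graph : ∀ d → Below Tame d → IsFunction d → [] ⊩ law d → HasGraph d
  law⇒graph X⋆ b f a = graph⇒value b f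
    (branch⇒value (∧-elim₁ (at a (v₁ ∷ []))) (∧-elim₂ (at a (v₁ ∷ []))) h₀)
  law⇒graph (op S []) b f a = graph⇒value b f
    (value-cong ≐-refl (≐-sym h₀) (at a (v₁ ∷ [])))
  law⇒graph (op ⊕ []) b f a = graph⇒value b f (value-by-pairs v₁
    (⇒-intro (value-cong ≐-refl
      (≐-sym (≐-trans h₁ (≐-trans (+-cong H≐0 T≐0) +0)))
      (∧-elim₂ (at {k = 2} a (𝟎 ∷ 𝟎 ∷ [])))))
    (⇒-intro (value-cong ≐-refl (≐-sym h₁) (∧-elim₁ (at {k = 2} a (H v₁ ∷ T v₁ ∷ []))))))
    where
    H≐0 : s ≐ 𝟎 ∷ Γ ⊩ H s ≐ 𝟎
    H≐0 = ≐-trans (H-cong h₀) H0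
    T≐0 : s ≐ 𝟎 ∷ Γ ⊩ T s ≐ 𝟎
    T≐0 = ≐-trans (T-cong h₀) T0
  law⇒graph (op ⊗ []) b f a = graph⇒value b f (value-by-pairs v₁
    (⇒-intro (value-cong ≐-refl
      (≐-sym (≐-trans h₁ (≐-trans (·-cong ≐-refl T≐0) ·0)))
      (∧-elim₂ (at {k = 2} a (𝟎 ∷ 𝟎 ∷ [])))))
    (⇒-intro (value-cong ≐-refl (≐-sym h₁) (∧-elim₁ (at {k = 2} a (H v₁ ∷ T v₁ ∷ []))))))
    where
    T≐0 : s ≐ 𝟎 ∷ Γ ⊩ T s ≐ 𝟎
    T≐0 = ≐-trans (T-cong h₀) T0
  law⇒graph (op <⋆ []) b f a = graph⇒value b f (branch⇒value
    (⇒-intro (value-by-pairs v₁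
      (⇒-intro (≮𝟎 (<-cong ≐-refl (≐-trans (T-cong h₀) T0) h₁)))
      (⇒-intro (⇒-elim (∧-elim₁ (at {k = 2} a (H v₁ ∷ T v₁ ∷ []))) h₁))))
    (⇒-intro (value-by-pairs v₁
      (⇒-intro (∧-elim₂ (∧-elim₂ (at {k = 2} a (𝟎 ∷ 𝟎 ∷ [])))))
      (⇒-intro (⇒-elim (∧-elim₁ (∧-elim₂ (at {k = 2} a (H v₁ ∷ T v₁ ∷ []))))
        (∨-elim (<-or-≥ (H v₁) (T v₁)) (contradiction h₀ h₂) h₀)))))
    h₀)
  law⇒graph (op I []) b f a = graph⇒value b f
    (value-cong ≐-refl (≐-sym h₀) (at a (v₁ ∷ [])))
  law⇒graph (op D []) b f a = graph⇒value b f (branch⇒value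
    (⇒-intro (value-by-pairs v₁
      (⇒-intro (value-cong ≐-refl
        (≐-sym (≐-trans (H-cong (≐-trans (T-cong h₀) T0)) H0)) at-0))
      (⇒-intro (∨-elim (0-or-pair (T v₁))
        (value-cong (⟪⟫-cong ≐-refl (≐-sym h₀)) (≐-sym (≐-trans (H-cong h₀) H0)) at-⟪,0⟫)
        (value-cong (⟪⟫-cong (≐-sym h₂) (≐-sym h₀)) ≐-refl
          (∧-elim₁ (at {k = 3} a (𝟎 ∷ H (T v₁) ∷ T (T v₁) ∷ []))))))))
    (⇒-intro (value-by-pairs v₁
      (⇒-intro (value-cong ≐-refl
        (≐-sym (≐-trans (T-cong (≐-trans (T-cong h₀) T0)) T0)) at-0))
      (⇒-intro (∨-elim (0-or-pair (T v₁))
        (value-cong (⟪⟫-cong ≐-refl (≐-sym h₀)) (≐-sym (≐-trans (T-cong h₀) T0)) at-⟪,0⟫)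
        (∨-elim (0-or-positive (H v₁))
          (contradiction h₀ h₃)
          (∃-elim (predecessor h₀)
            (value-cong (⟪⟫-cong (∧-elim₂ h₀) (≐-sym h₂)) ≐-refl
              (∧-elim₁ (∧-elim₂
                (at {k = 3} a (v₀ ∷ H (T v₂) ∷ T (T v₂) ∷ [])))))))))))
    h₀)
    where
    at-0 : Γ ⊩ 𝐟 (op D []) ⟨ 𝟎 ⟩≐ 𝟎
    at-0 = ∧-elim₁ (∧-elim₂ (∧-elim₂ (at {k = 3} a (𝟎 ∷ 𝟎 ∷ 𝟎 ∷ []))))
    at-⟪,0⟫ : Γ ⊩ 𝐟 (op D []) ⟨ ⟪ s , 𝟎 ⟫ ⟩≐ 𝟎
    at-⟪,0⟫ {s = s} = ∧-elim₂ (∧-elim₂ (∧-elim₂ (at {k = 3} a (s ∷ 𝟎 ∷ 𝟎 ∷ []))))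
  law⇒graph (op P (g ∷ h ∷ [])) b f a = graph⇒value b f
    (value-cong ≐-refl (≐-sym (pair-η (∧-elim₁ h₀)))
      (⇒-elim (at {k = 3} a (v₁ ∷ H v₀ ∷ T v₀ ∷ [])) (∧-elim₂ h₀)))
  law⇒graph (op ∘ (g ∷ h ∷ [])) b f a = graph⇒value b f
    (∃-elim h₀ (⇒-elim (at {k = 3} a (v₂ ∷ v₁ ∷ v₀ ∷ [])) (∧-elim₂ h₀)))
  law⇒graph (op μ (g ∷ [])) b f a = value⇒graph b f (∨-elim (0-or-pair v₁)
    (cut (Function.unique f (value-cong h₀ ≐-refl h₁) at-0)
      (∧-intro (≤-cong (≐-sym h₀) ≐-refl 0≤) (∧-intro
        (∀-intro (⇒-intro (⇒-intro (≤-cong (≐-sym h₂) ≐-refl 0≤))))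
        (⇒-intro (≮𝟎 (<-cong ≐-refl (≐-trans (H-cong h₂) H0) h₀))))))
    (cut (value-cong h₀ ≐-refl h₁)
      (∧-intro (⇒-elim (∧-elim₁ (at {k = 4} a (T v₁ ∷ 𝟎 ∷ v₀ ∷ H v₁ ∷ []))) h₀) (∧-intro
        (∀-intro (⇒-intro (⇒-intro (⇒-elim (∧-elim₁ (∧-elim₂ (at {k = 4} a (T v₂ ∷ v₀ ∷ v₁ ∷ H v₂ ∷ []))))
          (∧-intro h₂ (∧-intro h₁ h₀))))))
        (⇒-intro (⇒-elim (∧-elim₁ (∧-elim₂ (∧-elim₂ (at {k = 4} a (T v₁ ∷ 𝟎 ∷ v₀ ∷ H v₁ ∷ [])))))
          (∧-intro h₁ h₀)))))))
    where
    at-0 : Γ ⊩ 𝐟 (op μ (g ∷ [])) ⟨ 𝟎 ⟩≐ 𝟎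
    at-0 = ∧-elim₂ (∧-elim₂ (∧-elim₂ (at {k = 4} a (𝟎 ∷ 𝟎 ∷ 𝟎 ∷ 𝟎 ∷ []))))

⊑-intro : {Ax Ax′ : Theory C} → (∀ {φ} → Ax φ → Ax′ ⊢ φ) → Ax ⊑ Ax′
⊑-intro prove a = transfer axiom (λ ()) (prove a)

-- Bounds and explicit definitions in ΔRA₁

module ΔRA₁-Graphs where

  open Decision using (∈𝓕; ΔRA₁-induction)
  open Graphs {Ax = ΔRA₁} (λ b → axiom⁰ (basic b)) ΔRA₁-induction

  laws : ∀ d → ΔRA₁ ⊢ law d
  laws X⋆        = axiom⁰ oracle
  laws (op o ds) = axiom⁰ (operator o ds)

  tame : ∀ d → Tame d
  tame = derivation-induction Tame λ d below →
    ∈𝓕 d , has-bound (below-map proj₂ d below) (law⇒graph d below (∈𝓕 d) (laws d))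

  has-graph : ∀ d → HasGraph d
  has-graph d = law⇒graph d (below-all tame d) (∈𝓕 d) (laws d)

  has-definition : ∀ d → HasDefinition d
  has-definition = derivation-induction HasDefinition λ d below →
    graph⇒definition d below (Function.0∉ (∈𝓕 d)) (has-graph d)

  polynomially-bounded : ∀ d →
    Σ[ t ∈ Term 1 ] (ΔRA₁ ⊢ ∀̇ ∀̇ (𝐟 d ⟨ v₁ ⟩≐ v₀ ⇒ v₀ ≤ wkᵗ t))
  polynomially-bounded d = bound d v₀ ,
    along (cong (λ t → ∀̇ ∀̇ (𝐟 d ⟨ v₁ ⟩≐ v₀ ⇒ v₀ ≤ t)) (sym (bound-wkᵗ d v₀)))
      (closure-intro 2 (⇒-intro (proj₂ (tame d))))

-- The extension of bounded induction by explicit definitions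

Extended : Theory SetConst
Extended = IΔ⁰₀ ⊤ +Definitions definition

module Extended-Graphs where

  Extended-BASIC : ∀ {φ} → BASIC φ → Extended ⊢ φ
  Extended-BASIC S≠0      = axiom⁰ (old (basic S≠0))
  Extended-BASIC S-inj    = axiom⁰ (old (basic S-inj))
  Extended-BASIC +-zero   = axiom⁰ (old (basic +-zero))
  Extended-BASIC +-suc    = axiom⁰ (old (basic +-suc))
  Extended-BASIC ·-zero   = axiom⁰ (old (basic ·-zero))
  Extended-BASIC ·-suc    = axiom⁰ (old (basic ·-suc))
  Extended-BASIC ≮0       = axiom⁰ (old (basic ≮0))
  Extended-BASIC <-suc    = axiom⁰ (old (basic <-suc))
  Extended-BASIC <-cmp    = axiom⁰ (old (basic <-cmp))
  Extended-BASIC pred     = axiom⁰ (old (basic pred))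
  Extended-BASIC pair-def = axiom⁰ (old (basic pair-def))
  Extended-BASIC pair-inj = axiom⁰ (old (basic pair-inj))
  Extended-BASIC unpair   = axiom⁰ (old (basic unpair))
  Extended-BASIC H-pair   = axiom⁰ (old (basic H-pair))
  Extended-BASIC H-zero   = axiom⁰ (old (basic H-zero))
  Extended-BASIC T-pair   = axiom⁰ (old (basic T-pair))
  Extended-BASIC T-zero   = axiom⁰ (old (basic T-zero))

  eliminate : SetConst → Formula ⊤ 1
  eliminate 𝐗     = v₀ ∈ tt
  eliminate (𝐟 d) = definition d

  eliminate-bounded : ∀ f → Bounded (eliminate f)
  eliminate-bounded 𝐗     = v₀ ∈ tt
  eliminate-bounded (𝐟 d) = definition-bounded d

  eliminated : (φ : Formula SetConst n) →
               Extended ∣ [] ⊢ (φ ⇔ mapConst inj₁ (unfold eliminate φ))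
  eliminated φ = along
    (cong₂ _⇔_ (trans (unfold-constants (λ f → f) φ) (mapConst-id φ))
               (sym (mapConst-unfold inj₁ eliminate φ)))
    (unfold-cong (λ { 𝐗 → ⇔-refl ; (𝐟 d) → closure-elim 1 (axiom⁰ (define d)) }) φ)

  -- Eliminating the functions leaves a bounded formula in X, for which induction
  -- is an axiom.
  Extended-induction : {φ : Formula SetConst (suc n)} → Bounded φ →
                       Extended ∣ [] ⊢ progressive⇒all φ
  Extended-induction {n = n} {φ = φ} b = progressive⇒all-cong (eliminated φ)
    (closure-elim n (along (mapConst-induction inj₁ (unfold eliminate φ))
      (axiom⁰ (old (ind (bounded-unfold eliminate-bounded b))))))

  open Graphs {Ax = Extended} Extended-BASIC Extended-induction

  has-definition : ∀ d → HasDefinition d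
  has-definition d = closure-elim 1 (axiom⁰ (define d))

  has-graph : ∀ d → HasGraph d
  has-graph d = definition⇒graph d (below-all has-definition d) (has-definition d)

  tame : ∀ d → Tame d
  tame = derivation-induction Tame λ d below →
    graph⇒function d below
      (definition⇒0∉ d (below-all has-definition d) (has-definition d)) (has-graph d)
    , has-bound (below-map proj₂ d below) (has-graph d)

  laws : ∀ d → Extended ⊢ law d
  laws d = graph⇒law d (below-all tame d) (has-graph d)

Extended⊑ΔRA₁ : Extended ⊑ ΔRA₁
Extended⊑ΔRA₁ = ⊑-intro {Ax = Extended} λ
  { (old (basic b))           → axiom⁰ (basic (mapConst-BASIC inj₁ b))
  ; (old (ind {n} {φ} b)) → along (sym (mapConst-induction inj₁ φ))
      (closure-intro n (Decision.ΔRA₁-induction (mapConst-bounded inj₁ b)))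
  ; (define d)                → ∀-intro (ΔRA₁-Graphs.has-definition d) }

ΔRA₁⊑Extended : ΔRA₁ ⊑ Extended
ΔRA₁⊑Extended = ⊑-intro {Ax = ΔRA₁} λ
  { (basic b)           → Extended-Graphs.Extended-BASIC b
  ; oracle              → Extended-Graphs.laws X⋆
  ; oracle-∈𝓕           → proj₁ (Extended-Graphs.tame X⋆)
  ; (operator o ds)     → Extended-Graphs.laws (op o ds)
  ; (operator-∈𝓕 o ds) → proj₁ (Extended-Graphs.tame (op o ds)) }

theorem7p7 : ( (∀ (n : ℕ) (φ : Formula SetConst (suc n)) → Bounded φ → (ΔRA₁ ⊢ induction φ))
    × (∀ (d : Derivation) → Σ[ t ∈ Term 1 ] (ΔRA₁ ⊢ ∀̇ ∀̇ (𝐟 d ⟨ v₁ ⟩≐ v₀ ⇒ v₀ ≤ wkᵗ t))) )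
    × IsExtensionByDefinitionsOf ΔRA₁ (IΔ⁰₀ ⊤)
theorem7p7 =
    ( (λ n φ b → closure-intro n (Decision.ΔRA₁-induction b))
    , ΔRA₁-Graphs.polynomially-bounded )
  , definition , λ φ → mk⇔ (transfer-sentence Extended⊑ΔRA₁)
                           (transfer-sentence ΔRA₁⊑Extended)
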